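{- As formal power series in $u$ and $t$, $$\sum_{n\ge0}\frac{u^n}{(t;q)_{n+1}\,[\hat n]_{a,p}!}\sum_{\beta\in B_n}t^{\mathrm{des}_B(\beta)}q^{\mathrm{maj}(\beta)}p^{\ell_B(\beta)}a^{\mathrm{neg}(\beta)}=\sum_{k\ge0}t^k\prod_{j=0}^{k-1}e[q^ju]_p\cdot\hat e[q^ku]_{a,p}.$$
   Context: $B_n$ is the group of signed permutations of $[n]$ (bijections $\beta$ of $[-n,n]\setminus\{0\}$ with $\beta(-i)=-\beta(i)$), written $\beta=[\beta(1),\dots,\beta(n)]$; $B_0$ is the trivial group. $\mathrm{neg}(\beta)=|\{i:\beta(i)<0\}|$. $\mathrm{Des}_B(\beta)=\{i\in[0,n-1]:\beta(i)>\beta(i+1)\}$ with the natural order on integers and $\beta(0):=0$; $\mathrm{des}_B=|\mathrm{Des}_B|$, $\mathrm{maj}(\beta)=\sum_{i\in\mathrm{Des}_B(\beta)}i$. $\ell_B$ is the Coxeter length of $B_n$ with respect to the generators $s_i=[1,\dots,i-1,i+1,i,i+2,\dots,n]$ ($1\le i\le n-1$) and $s_0=[-1,2,\dots,n]$; equivalently $\ell_B(\beta)=\mathrm{inv}(\beta)-\sum_{i:\beta(i)<0}\beta(i)$, where $\mathrm{inv}(\beta)=|\{(i,j):1\le i<j\le n,\ \beta(i)>\beta(j)\}|$. Notation: $(x;p)_0=1$, $(x;p)_n=(1-x)(1-xp)\cdots(1-xp^{n-1})$; $[n]_p=1+p+\dots+p^{n-1}$, $[n]_p!=[n]_p[n-1]_p\cdots[1]_p$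 with $[0]_p!=1$; $[\hat n]_{a,p}!=(-ap;p)_n[n]_p!$; $e[u]_p=\sum_{n\ge0}u^n/[n]_p!$ and $\hat e[u]_{a,p}=\sum_{n\ge0}u^n/[\hat n]_{a,p}!$. -}

module Defs where

open import Level using (Level)
open import Data.Bool using (Bool; true; false; not; if_then_else_; _∧_)
open import Data.Nat as ℕ using (ℕ; zero; suc; _≡ᵇ_)
open import Data.Integer as ℤ using (ℤ; +_; -[1+_]; _≤ᵇ_; ∣_∣)
open import Data.List using (List; []; _∷_; _++_; map; foldr; filter; concatMap; upTo; length)
open import Algebra.Bundles using (CommutativeRing)

infix 4 _>ᵇ_
_>ᵇ_ : ℤ → ℤ → Bool
x >ᵇ y = not (x ≤ᵇ y)

allLists : {A : Set} → ℕ → List A → List (List A)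
allLists zero    xs = [] ∷ []
allLists (suc n) xs = concatMap (λ x → map (x ∷_) (allLists n xs)) xs

signedRange : ℕ → List ℤ
signedRange n = map (λ i → + suc i) (upTo n) ++ map (λ i → -[1+ i ]) (upTo n)

notIn : ℕ → List ℕ → Bool
notIn x []       = true
notIn x (y ∷ ys) = not (x ≡ᵇ y) ∧ notIn x ys

distinct : List ℕ → Bool
distinct []       = true
distinct (x ∷ xs) = notIn x xs ∧ distinct xs

-- B_n: a signed permutation β is the list [β(1), …, β(n)]; the maps
-- [n] → [-n,n]∖{0} whose absolute values are pairwise distinct are exactly
-- the signed permutations (extended by β(-i) = -β(i)).
B : ℕ → List (List ℤ)
B n = filter (λ β → Data.Bool._≟_ (distinct (map ∣_∣ β)) true) (allLists n (signedRange n))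
  where import Data.Bool

negStat : List ℤ → ℕ
negStat []       = 0
negStat (x ∷ xs) = (if (+ 0) >ᵇ x then 1 else 0) ℕ.+ negStat xs

descentPositions : ℕ → List ℤ → List ℕ
descentPositions start []           = []
descentPositions start (x ∷ [])     = []
descentPositions start (x ∷ y ∷ ys) =
  (if x >ᵇ y then (start ∷ []) else []) ++ descentPositions (suc start) (y ∷ ys)

-- Des_B(β) ⊆ [0, n-1], with β(0) := 0
DesB : List ℤ → List ℕ
DesB β = descentPositions 0 (+ 0 ∷ β)

desB : List ℤ → ℕ
desB β = length (DesB β)

maj : List ℤ → ℕ
maj β = foldr ℕ._+_ 0 (DesB β)

inv : List ℤ → ℕ
inv []       = 0
inv (x ∷ xs) = length (filter (λ y → Data.Bool._≟_ (x >ᵇ y) true) xs) ℕ.+ inv xs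
  where import Data.Bool

negSum : List ℤ → ℕ
negSum []       = 0
negSum (x ∷ xs) = (if (+ 0) >ᵇ x then ∣ x ∣ else 0) ℕ.+ negSum xs

ℓB : List ℤ → ℕ
ℓB β = inv β ℕ.+ negSum β

module Series {c ℓ : Level} (R : CommutativeRing c ℓ) where
  open CommutativeRing R

  infixr 8 _^_
  _^_ : Carrier → ℕ → Carrier
  x ^ zero  = 1#
  x ^ suc n = x * (x ^ n)

  sumL : List Carrier → Carrier
  sumL = foldr _+_ 0#

  prodL : List Carrier → Carrier
  prodL = foldr _*_ 1#

  sumTo : ℕ → (ℕ → Carrier) → Carrier
  sumTo m f = sumL (map f (upTo m))

  prodTo : ℕ → (ℕ → Carrier) → Carrier
  prodTo m f = prodL (map f (upTo m))

  PS : Set c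
  PS = ℕ → Carrier

  oneS : PS
  oneS zero    = 1#
  oneS (suc _) = 0#

  _·S_ : PS → PS → PS
  (f ·S g) n = sumTo (suc n) (λ i → f i * g (n ℕ.∸ i))

  prodS : List PS → PS
  prodS = foldr _·S_ oneS

  -- 1 / (1 - x z) = Σ_m x^m z^m
  geom : Carrier → PS
  geom x m = x ^ m

  -- 1 / (t;q)_{n+1} = Π_{j=0}^{n} 1/(1 - q^j t), as a power series in t
  invPoch : Carrier → ℕ → PS
  invPoch q n = prodS (map (λ j → geom (q ^ j)) (upTo (suc n)))

  qint : Carrier → ℕ → Carrier
  qint p m = sumTo m (λ i → p ^ i)

  -- Given invQ m = ([m+1]_p)^{-1} and invN i = (1 + a p^{i+1})^{-1}:
  -- 1/[n]_p!  =  Π_{m<n} invQ m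
  invFact : (ℕ → Carrier) → ℕ → Carrier
  invFact invQ n = prodTo n invQ

  -- 1/[n̂]_{a,p}! = 1/((-ap;p)_n [n]_p!)  =  Π_{i<n} invN i · Π_{m<n} invQ m
  invHatFact : (ℕ → Carrier) → (ℕ → Carrier) → ℕ → Carrier
  invHatFact invQ invN n = prodTo n invN * invFact invQ n

  -- e[x u]_p as a power series in u
  eS : (ℕ → Carrier) → Carrier → PS
  eS invQ x m = (x ^ m) * invFact invQ m

  -- ê[x u]_{a,p} as a power series in u
  ehatS : (ℕ → Carrier) → (ℕ → Carrier) → Carrier → PS
  ehatS invQ invN x m = (x ^ m) * invHatFact invQ invN m

  -- Σ_{β ∈ B_n} t^{des_B β} q^{maj β} p^{ℓ_B β} a^{neg β}, as a (finite) power series in t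
  desPoly : Carrier → Carrier → Carrier → ℕ → PS
  desPoly q p a n k =
    sumL (map (λ β → if desB β ≡ᵇ k
                      then (q ^ maj β) * ((p ^ ℓB β) * (a ^ negStat β))
                      else 0#)
              (B n))

  -- LHS, coefficient of u^n t^k:
  --   [t^k] ( 1/((t;q)_{n+1} [n̂]_{a,p}!) Σ_{β∈B_n} t^des q^maj p^ℓ a^neg )
  lhsCoeff : Carrier → Carrier → Carrier → (ℕ → Carrier) → (ℕ → Carrier) → ℕ → ℕ → Carrier
  lhsCoeff q p a invQ invN n k =
    invHatFact invQ invN n * (invPoch q n ·S desPoly q p a n) k

  -- RHS, coefficient of u^n t^k:
  --   [u^n] ( Π_{j=0}^{k-1} e[q^j u]_p · ê[q^k u]_{a,p} )
  rhsCoeff : Carrier → Carrier → Carrier → (ℕ → Carrier) → (ℕ → Carrier) → ℕ → ℕ → Carrier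
  rhsCoeff q p a invQ invN n k =
    prodS (map (λ j → eS invQ (q ^ j)) (upTo k) ++ (ehatS invQ invN (q ^ k) ∷ [])) n

-- With xⱼ = q^j, the coefficient of t^k in Σ_β t^des q^maj p^ℓ a^neg / (t;q)ₙ₊₁ is the sum of
-- p^ℓ(β) a^neg(β) ∏ x_{cᵢ} over β ∈ Bₙ and sequences k = c₀ ≥ c₁ ≥ … ≥ cₙ ≥ 0 that decrease
-- strictly at the descents of β (β(0) = 0).  Such pairs are sorted words of coloured letters, so a letter ±n of
-- colour c can be inserted in just one position.  For arbitrary x this gives
--   Aₙ(x) = Σ_{c≤k} x_c Aₙ₋₁(x with xⱼ ↦ p xⱼ for j < c)
--         + a p^n Σ_{c<k} x_c Aₙ₋₁(x with xⱼ ↦ p xⱼ for j > c).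
-- By the q-Leibniz rule, [uⁿ] ∏_{j<k} e[xⱼ u] · ê[x_k u] satisfies the same recurrence, up to
-- the factor (1 + a p^n) [n]_p on the left-hand side.

module Submission where

open import Defs
open import Level using (Level)
open import Data.Bool using (Bool; true; false; not; if_then_else_; _∧_; T)
open import Data.Bool.Properties using (∧-zeroʳ)
open import Data.Nat as ℕ using (ℕ; zero; suc; _∸_; _<ᵇ_; _≡ᵇ_; _≤_; _<_; s≤s; z≤n)
import Data.Nat.Properties as ℕₚ
open import Data.Integer using (ℤ; +_; -[1+_]; ∣_∣)
open import Data.List using (List; []; _∷_; _++_; map; foldr; filter; concatMap; upTo; applyUpTo; length)
open import Data.List.Properties using (map-++; map-applyUpTo; map-upTo; upTo-∷ʳ)
open import Data.List.Membership.Propositional using (_∈_)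
open import Data.List.Membership.Propositional.Properties
  using (∈-upTo⁻; ∈-filter⁻; ∈-concatMap⁻; ∈-map⁻; ∈-++⁻)
open import Data.List.Relation.Unary.All as All using (All; []; _∷_)
open import Data.List.Relation.Unary.Any using (Any; here; there)
open import Data.Product using (_×_; _,_; proj₁; proj₂)
open import Data.Sum using (inj₁; inj₂)
open import Data.Unit using (tt)
open import Function using (_∘_)
open import Relation.Nullary using (contradiction)
open import Relation.Binary.PropositionalEquality as ≡ using (_≡_; _≢_)
open import Algebra.Bundles using (CommutativeRing)
import Algebra.Solver.Ring.NaturalCoefficients.Default as NatSolver
import Relation.Binary.Reasoning.Setoid as SetoidReasoning

-- Signed permutations as lists

-- The scalings in the recurrence destroy the shape q^j of the variables, so the induction on n has
-- to run over all x at once; powers of q are substituted only at the end. `B n` is a filter of all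
-- lists of letters, which does not exhibit a signed permutation as an insertion into a smaller one.
-- In place of a bijection there is an identity between sums, proved by recursion on the first
-- letter. Removing that letter shortens the list but keeps the alphabet, so the length m and the
-- range N vary independently. For m = N = n + 1 this leaves a surplus term, the words of length n +
-- 1 over the range n, which is empty by the pigeonhole principle. The two kinds of scaling have a
-- counterpart for the series: [i+j]_p splits both as [i]_p + p^i [j]_p and as [j]_p + p^j [i]_p,
-- and the two summands of (1 + a p^n) [n]_p need one splitting each.

insertAt : ℕ → ℤ → List ℤ → List ℤ
insertAt zero    v xs       = v ∷ xs
insertAt (suc j) v []       = v ∷ []
insertAt (suc j) v (x ∷ xs) = x ∷ insertAt j v xs

infix 4 _≺_
-- Kept as the values of the two Boolean tests, since `inv`, the descents and `chains` all branch on
-- `>ᵇ`; each component can be rewritten with directly.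
_≺_ : ℤ → ℤ → Set
x ≺ y = ((x >ᵇ y) ≡ false) × ((y >ᵇ x) ≡ true)

T⇒≡true : ∀ {b} → T b → b ≡ true
T⇒≡true {true} _ = ≡.refl

¬T⇒≡false : ∀ {b} → (T b → T false) → b ≡ false
¬T⇒≡false {false} _ = ≡.refl
¬T⇒≡false {true}  f = contradiction (f tt) (λ ())

<⇒<ᵇ≡true : ∀ {m n} → m < n → (m <ᵇ n) ≡ true
<⇒<ᵇ≡true m<n = T⇒≡true (ℕₚ.<⇒<ᵇ m<n)

≤⇒<ᵇ≡false : ∀ {m n} → n ≤ m → (m <ᵇ n) ≡ false
≤⇒<ᵇ≡false {m} {n} n≤m = ¬T⇒≡false (λ t → contradiction (ℕₚ.<ᵇ⇒< m n t) (ℕₚ.≤⇒≯ n≤m))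

≤⇒≤ᵇ≡true : ∀ {m n} → m ≤ n → (m ℕ.≤ᵇ n) ≡ true
≤⇒≤ᵇ≡true m≤n = T⇒≡true (ℕₚ.≤⇒≤ᵇ m≤n)

≢⇒≡ᵇ≡false : ∀ {m n} → m ≢ n → (m ≡ᵇ n) ≡ false
≢⇒≡ᵇ≡false {m} {n} m≢n = ¬T⇒≡false (λ t → contradiction (ℕₚ.≡ᵇ⇒≡ m n t) m≢n)

≡ᵇ-refl : ∀ n → (n ≡ᵇ n) ≡ true
≡ᵇ-refl n = T⇒≡true (ℕₚ.≡⇒≡ᵇ n n ≡.refl)

∣z∣<v⇒z≺+v : ∀ N z → ∣ z ∣ < suc N → z ≺ + suc N
∣z∣<v⇒z≺+v N (+ m)     (s≤s m≤N)
  rewrite ≤⇒≤ᵇ≡true (ℕₚ.m≤n⇒m≤1+n m≤N) | ≤⇒<ᵇ≡false m≤N = ≡.refl , ≡.refl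
∣z∣<v⇒z≺+v N (-[1+ m ]) _ = ≡.refl , ≡.refl

∣z∣<v⇒-v≺z : ∀ N z → ∣ z ∣ < suc N → -[1+ N ] ≺ z
∣z∣<v⇒-v≺z N (+ m)      _ = ≡.refl , ≡.refl
∣z∣<v⇒-v≺z (suc N) (-[1+ m ]) (s≤s (s≤s m≤N))
  rewrite ≤⇒≤ᵇ≡true (ℕₚ.m≤n⇒m≤1+n m≤N) | ≤⇒<ᵇ≡false m≤N = ≡.refl , ≡.refl

-- Length and sign statistics under insertion of a letter

boolToℕ : Bool → ℕ
boolToℕ b = if b then 1 else 0

ℕ-leftComm : ∀ a b c → a ℕ.+ (b ℕ.+ c) ≡ b ℕ.+ (a ℕ.+ c)
ℕ-leftComm a b c = ≡.trans (≡.sym (ℕₚ.+-assoc a b c))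
  (≡.trans (≡.cong (ℕ._+ c) (ℕₚ.+-comm a b)) (ℕₚ.+-assoc b a c))

-- A statistic that adds up over the letters does not see their order, so the position drops out.
-- This serves `countBelow`, `negStat` and `negSum`.
additive-insertAt : (f : ℤ → ℕ) (s : List ℤ → ℕ) → (∀ x xs → s (x ∷ xs) ≡ f x ℕ.+ s xs) →
  ∀ j v xs → s (insertAt j v xs) ≡ f v ℕ.+ s xs
additive-insertAt f s s-∷ zero    v xs       = s-∷ v xs
additive-insertAt f s s-∷ (suc j) v []       = s-∷ v []
additive-insertAt f s s-∷ (suc j) v (x ∷ xs)
  rewrite s-∷ x (insertAt j v xs) | additive-insertAt f s s-∷ j v xs | s-∷ x xs =
  ℕ-leftComm (f x) (f v) (s xs)

countBelow : ℤ → List ℤ → ℕ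
countBelow x = length ∘ filter (λ y → (x >ᵇ y) Data.Bool.≟ true)

countBelow-∷ : ∀ x y ys → countBelow x (y ∷ ys) ≡ boolToℕ (x >ᵇ y) ℕ.+ countBelow x ys
countBelow-∷ x y ys with x >ᵇ y
... | true  = ≡.refl
... | false = ≡.refl

countBelow-insertAt : ∀ x j v xs →
  countBelow x (insertAt j v xs) ≡ boolToℕ (x >ᵇ v) ℕ.+ countBelow x xs
countBelow-insertAt x = additive-insertAt (λ y → boolToℕ (x >ᵇ y)) (countBelow x) (countBelow-∷ x)

countBelow-max : ∀ v xs → All (_≺ v) xs → countBelow v xs ≡ length xs
countBelow-max v []       []         = ≡.refl
countBelow-max v (x ∷ xs) (x≺v ∷ ps)
  rewrite countBelow-∷ v x xs | proj₂ x≺v = ≡.cong suc (countBelow-max v xs ps)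

countBelow-min : ∀ v xs → All (v ≺_) xs → countBelow v xs ≡ 0
countBelow-min v []       []         = ≡.refl
countBelow-min v (x ∷ xs) (v≺x ∷ ps)
  rewrite countBelow-∷ v x xs | proj₁ v≺x = countBelow-min v xs ps

-- A maximum is inverted with each letter to its right and with none to its left. If `j` exceeds the
-- length, `insertAt` appends `v`, in accordance with truncated subtraction.
inv-insertAt-max : ∀ j v xs → All (_≺ v) xs → inv (insertAt j v xs) ≡ (length xs ∸ j) ℕ.+ inv xs
inv-insertAt-max zero    v xs       ps = ≡.cong (ℕ._+ inv xs) (countBelow-max v xs ps)
inv-insertAt-max (suc j) v []       ps = ≡.refl
inv-insertAt-max (suc j) v (x ∷ xs) (x≺v ∷ ps)
  rewrite countBelow-insertAt x j v xs | proj₁ x≺v | inv-insertAt-max j v xs ps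
        | ≡.sym (ℕₚ.+-assoc (countBelow x xs) (length xs ∸ j) (inv xs))
        | ℕₚ.+-comm (countBelow x xs) (length xs ∸ j) =
  ℕₚ.+-assoc (length xs ∸ j) (countBelow x xs) (inv xs)

-- A minimum is inverted with the letters to its left. There are `j` of them only if `j` does not
-- overshoot the end of the word.
inv-insertAt-min : ∀ j v xs → j ≤ length xs → All (v ≺_) xs → inv (insertAt j v xs) ≡ j ℕ.+ inv xs
inv-insertAt-min zero    v xs       _ ps = ≡.cong (ℕ._+ inv xs) (countBelow-min v xs ps)
inv-insertAt-min (suc j) v (x ∷ xs) (s≤s j≤) (v≺x ∷ ps)
  rewrite countBelow-insertAt x j v xs | proj₂ v≺x | inv-insertAt-min j v xs j≤ ps
        | ≡.sym (ℕₚ.+-assoc (countBelow x xs) j (inv xs)) | ℕₚ.+-comm (countBelow x xs) j =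
  ≡.cong suc (ℕₚ.+-assoc j (countBelow x xs) (inv xs))

negStat-insertAt : ∀ j v xs → negStat (insertAt j v xs) ≡ boolToℕ ((+ 0) >ᵇ v) ℕ.+ negStat xs
negStat-insertAt = additive-insertAt _ negStat (λ _ _ → ≡.refl)

negSum-insertAt : ∀ j v xs →
  negSum (insertAt j v xs) ≡ (if (+ 0) >ᵇ v then ∣ v ∣ else 0) ℕ.+ negSum xs
negSum-insertAt = additive-insertAt _ negSum (λ _ _ → ≡.refl)

-- At `y = + 0` these are `desB` and `maj`. A free predecessor `y` permits recursion along the word,
-- each letter becoming the predecessor of the next.
descentCount descentSum : ℤ → List ℤ → ℕ
descentCount y zs = length (descentPositions 0 (y ∷ zs))
descentSum   y zs = foldr ℕ._+_ 0 (descentPositions 0 (y ∷ zs))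

length-descentPositions-suc : ∀ s x zs →
  length (descentPositions (suc s) (x ∷ zs)) ≡ length (descentPositions s (x ∷ zs))
length-descentPositions-suc s x []       = ≡.refl
length-descentPositions-suc s x (y ∷ zs) with x >ᵇ y
... | true  = ≡.cong suc (length-descentPositions-suc (suc s) y zs)
... | false = length-descentPositions-suc (suc s) y zs

sum-descentPositions-suc : ∀ s x zs → foldr ℕ._+_ 0 (descentPositions (suc s) (x ∷ zs)) ≡
  length (descentPositions s (x ∷ zs)) ℕ.+ foldr ℕ._+_ 0 (descentPositions s (x ∷ zs))
sum-descentPositions-suc s x []       = ≡.refl
sum-descentPositions-suc s x (y ∷ zs) with x >ᵇ y
... | true  = ≡.cong suc (≡.trans (≡.cong (s ℕ.+_) (sum-descentPositions-suc (suc s) y zs))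
                                  (ℕ-leftComm s (length (descentPositions (suc s) (y ∷ zs))) _))
... | false = sum-descentPositions-suc (suc s) y zs

descentCount-∷ : ∀ y z zs → descentCount y (z ∷ zs) ≡ boolToℕ (y >ᵇ z) ℕ.+ descentCount z zs
descentCount-∷ y z zs with y >ᵇ z
... | true  = ≡.cong suc (length-descentPositions-suc 0 z zs)
... | false = length-descentPositions-suc 0 z zs

-- A descent from `y` to `z` has position 0 and adds nothing, while every descent of `z ∷ zs` moves
-- one place to the right and adds one more than before.
descentSum-∷ : ∀ y z zs → descentSum y (z ∷ zs) ≡ descentCount z zs ℕ.+ descentSum z zs
descentSum-∷ y z zs with y >ᵇ z
... | true  = sum-descentPositions-suc 0 z zs
... | false = sum-descentPositions-suc 0 z zs

-- Distinctness and bounds of absolute values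

absDistinct : List ℤ → Bool
absDistinct = distinct ∘ map ∣_∣

Occurs : ℕ → List ℤ → Set
Occurs v = Any (λ x → ∣ x ∣ ≡ v)

-- Shaped for recursion on the first letter: once a letter of absolute value `v` has been removed by
-- `here`, vanishing on `OccursTwice` becomes vanishing on `Occurs` for the tail.
data OccursTwice (v : ℕ) : List ℤ → Set where
  here  : ∀ {x xs} → ∣ x ∣ ≡ v → Occurs v xs → OccursTwice v (x ∷ xs)
  there : ∀ {x xs} → OccursTwice v xs → OccursTwice v (x ∷ xs)

occurs⇒¬notIn : ∀ {v xs} → Occurs v xs → notIn v (map ∣_∣ xs) ≡ false
occurs⇒¬notIn {v} (here ≡.refl) rewrite ≡ᵇ-refl v = ≡.refl
occurs⇒¬notIn {v} {x ∷ _} (there p) rewrite occurs⇒¬notIn p = ∧-zeroʳ (not (v ≡ᵇ ∣ x ∣))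

occursTwice⇒¬absDistinct : ∀ {v xs} → OccursTwice v xs → absDistinct xs ≡ false
occursTwice⇒¬absDistinct (here ≡.refl p) rewrite occurs⇒¬notIn p = ≡.refl
occursTwice⇒¬absDistinct {xs = x ∷ xs} (there p)
  rewrite occursTwice⇒¬absDistinct p = ∧-zeroʳ (notIn ∣ x ∣ (map ∣_∣ xs))

notIn-insertAt : ∀ {u} j v xs → u ≢ ∣ v ∣ →
  notIn u (map ∣_∣ (insertAt j v xs)) ≡ notIn u (map ∣_∣ xs)
notIn-insertAt zero    v xs       u≢v rewrite ≢⇒≡ᵇ≡false u≢v = ≡.refl
notIn-insertAt (suc j) v []       u≢v rewrite ≢⇒≡ᵇ≡false u≢v = ≡.refl
notIn-insertAt {u} (suc j) v (x ∷ xs) u≢v =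
  ≡.cong (not (u ≡ᵇ ∣ x ∣) ∧_) (notIn-insertAt j v xs u≢v)

all<⇒notIn : ∀ u xs → All (λ z → ∣ z ∣ < u) xs → notIn u (map ∣_∣ xs) ≡ true
all<⇒notIn u []       []       = ≡.refl
all<⇒notIn u (x ∷ xs) (p ∷ ps) rewrite ≢⇒≡ᵇ≡false (ℕₚ.<⇒≢ p ∘ ≡.sym) = all<⇒notIn u xs ps

absDistinct-insertAt : ∀ j v xs → All (λ z → ∣ z ∣ < ∣ v ∣) xs →
  absDistinct (insertAt j v xs) ≡ absDistinct xs
absDistinct-insertAt zero    v xs       ps rewrite all<⇒notIn ∣ v ∣ xs ps = ≡.refl
absDistinct-insertAt (suc j) v []       ps = ≡.refl
absDistinct-insertAt (suc j) v (x ∷ xs) (p ∷ ps) =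
  ≡.cong₂ _∧_ (notIn-insertAt j v xs (ℕₚ.<⇒≢ p)) (absDistinct-insertAt j v xs ps)

∈-signedRange⁻ : ∀ N {x} → x ∈ signedRange N → ∣ x ∣ < suc N
∈-signedRange⁻ N x∈ with ∈-++⁻ (map (λ i → + suc i) (upTo N)) x∈
... | inj₁ p with _ , i∈ , ≡.refl ← ∈-map⁻ _ p = s≤s (∈-upTo⁻ i∈)
... | inj₂ p with _ , i∈ , ≡.refl ← ∈-map⁻ _ p = s≤s (∈-upTo⁻ i∈)

Bounded : ℕ → ℕ → List ℤ → Set
Bounded m N β = length β ≡ m × All (λ z → ∣ z ∣ < suc N) β

∈-allLists⁻ : ∀ m N {β} → β ∈ allLists m (signedRange N) → Bounded m N β
∈-allLists⁻ zero    N (here ≡.refl) = ≡.refl , []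
∈-allLists⁻ (suc m) N {β} β∈ =
  go (signedRange N) (∈-signedRange⁻ N) (∈-concatMap⁻ (λ x → map (x ∷_) (allLists m (signedRange N))) β∈)
  where
  go : ∀ xs → (∀ {x} → x ∈ xs → ∣ x ∣ < suc N) →
    Any (λ x → β ∈ map (x ∷_) (allLists m (signedRange N))) xs → Bounded (suc m) N β
  go (x ∷ xs) bound (here p) with _ , γ∈ , ≡.refl ← ∈-map⁻ (x ∷_) p
    with len , all ← ∈-allLists⁻ m N γ∈ = ≡.cong suc len , bound (here ≡.refl) ∷ all
  go (x ∷ xs) bound (there p) = go xs (bound ∘ there) p

-- B n is signedPerms n n.
signedPerms : ℕ → ℕ → List (List ℤ)
signedPerms m N = filter (λ β → absDistinct β Data.Bool.≟ true) (allLists m (signedRange N))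

∈-signedPerms⁻ : ∀ m N {β} → β ∈ signedPerms m N → Bounded m N β
∈-signedPerms⁻ m N β∈ =
  ∈-allLists⁻ m N (proj₁ (∈-filter⁻ (λ β → absDistinct β Data.Bool.≟ true) β∈))

module Generating {c ℓ : Level} (R : CommutativeRing c ℓ) where

  open CommutativeRing R hiding (zero)
  open Series R
  open NatSolver commutativeSemiring using (solve; _:=_; _:+_; _:*_; con)
  open SetoidReasoning setoid

  -- Finite sums

  ∑ : {A : Set} → List A → (A → Carrier) → Carrier
  ∑ xs f = sumL (map f xs)

  ∑-cong∈ : {A : Set} (xs : List A) {f g : A → Carrier} →
    (∀ {x} → x ∈ xs → f x ≈ g x) → ∑ xs f ≈ ∑ xs g
  ∑-cong∈ []       h = refl
  ∑-cong∈ (x ∷ xs) h = +-cong (h (here ≡.refl)) (∑-cong∈ xs (h ∘ there))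

  ∑-cong : {A : Set} (xs : List A) {f g : A → Carrier} → (∀ x → f x ≈ g x) → ∑ xs f ≈ ∑ xs g
  ∑-cong xs h = ∑-cong∈ xs (λ {x} _ → h x)

  ∑-zero : {A : Set} (xs : List A) → ∑ xs (λ _ → 0#) ≈ 0#
  ∑-zero []       = refl
  ∑-zero (x ∷ xs) = trans (+-identityˡ _) (∑-zero xs)

  +-interchange : ∀ a b c d → (a + b) + (c + d) ≈ (a + c) + (b + d)
  +-interchange = solve 4 (λ a b c d → (a :+ b) :+ (c :+ d) := (a :+ c) :+ (b :+ d)) refl

  ∑-+ : {A : Set} (xs : List A) (f g : A → Carrier) → ∑ xs (λ x → f x + g x) ≈ ∑ xs f + ∑ xs g
  ∑-+ []       f g = sym (+-identityˡ 0#)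
  ∑-+ (x ∷ xs) f g = trans (+-congˡ (∑-+ xs f g)) (+-interchange _ _ _ _)

  *-∑ : {A : Set} (xs : List A) (a : Carrier) (f : A → Carrier) → a * ∑ xs f ≈ ∑ xs (λ x → a * f x)
  *-∑ []       a f = zeroʳ a
  *-∑ (x ∷ xs) a f = trans (distribˡ _ _ _) (+-congˡ (*-∑ xs a f))

  ∑-swap : {A C : Set} (xs : List A) (ys : List C) (f : A → C → Carrier) →
    ∑ xs (λ x → ∑ ys (f x)) ≈ ∑ ys (λ y → ∑ xs (λ x → f x y))
  ∑-swap []       ys f = sym (∑-zero ys)
  ∑-swap (x ∷ xs) ys f = trans (+-congˡ (∑-swap xs ys f)) (sym (∑-+ ys _ _))

  ∑-++ : {A : Set} (xs ys : List A) (f : A → Carrier) → ∑ (xs ++ ys) f ≈ ∑ xs f + ∑ ys f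
  ∑-++ []       ys f = sym (+-identityˡ _)
  ∑-++ (x ∷ xs) ys f = trans (+-congˡ (∑-++ xs ys f)) (sym (+-assoc _ _ _))

  ∑-map : {A C : Set} (h : A → C) (xs : List A) (f : C → Carrier) → ∑ (map h xs) f ≈ ∑ xs (f ∘ h)
  ∑-map h []       f = refl
  ∑-map h (x ∷ xs) f = +-congˡ (∑-map h xs f)

  ∑-concatMap : {A C : Set} (h : A → List C) (xs : List A) (f : C → Carrier) →
    ∑ (concatMap h xs) f ≈ ∑ xs (λ x → ∑ (h x) f)
  ∑-concatMap h []       f = refl
  ∑-concatMap h (x ∷ xs) f = trans (∑-++ (h x) _ f) (+-congˡ (∑-concatMap h xs f))

  ∑-filter : {A : Set} (b : A → Bool) (xs : List A) (f : A → Carrier) →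
    ∑ (filter (λ x → b x Data.Bool.≟ true) xs) f ≈ ∑ xs (λ x → if b x then f x else 0#)
  ∑-filter b []       f = refl
  ∑-filter b (x ∷ xs) f with b x
  ... | true  = +-congˡ (∑-filter b xs f)
  ... | false = trans (∑-filter b xs f) (sym (+-identityˡ _))

  sumTo-cong : ∀ n {f g} → (∀ i → i < n → f i ≈ g i) → sumTo n f ≈ sumTo n g
  sumTo-cong n h = ∑-cong∈ (upTo n) (λ {i} i∈ → h i (∈-upTo⁻ i∈))

  map-upTo-suc : ∀ {A : Set c} n (f : ℕ → A) → map f (upTo (suc n)) ≡ f 0 ∷ map (f ∘ suc) (upTo n)
  map-upTo-suc n f =
    ≡.cong (f 0 ∷_) (≡.trans (map-applyUpTo suc f n) (≡.sym (map-upTo (f ∘ suc) n)))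

  sumTo-cons : ∀ n f → sumTo (suc n) f ≈ f 0 + sumTo n (f ∘ suc)
  sumTo-cons n f = reflexive (≡.cong sumL (map-upTo-suc n f))

  sumTo-snoc : ∀ n f → sumTo (suc n) f ≈ sumTo n f + f n
  sumTo-snoc n f = begin
    sumTo (suc n) f             ≡⟨ ≡.cong (λ l → ∑ l f) (≡.sym (upTo-∷ʳ n)) ⟩
    ∑ (upTo n ++ n ∷ []) f      ≈⟨ ∑-++ (upTo n) (n ∷ []) f ⟩
    sumTo n f + (f n + 0#)      ≈⟨ +-congˡ (+-identityʳ _) ⟩
    sumTo n f + f n             ∎

  prodL-snoc : ∀ xs y → prodL (xs ++ y ∷ []) ≈ prodL xs * y
  prodL-snoc []       y = trans (*-identityʳ y) (sym (*-identityˡ y))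
  prodL-snoc (x ∷ xs) y = trans (*-congˡ (prodL-snoc xs y)) (sym (*-assoc _ _ _))

  prodTo-snoc : ∀ n f → prodTo (suc n) f ≈ prodTo n f * f n
  prodTo-snoc n f = begin
    prodTo (suc n) f                    ≡⟨ ≡.cong (prodL ∘ map f) (≡.sym (upTo-∷ʳ n)) ⟩
    prodL (map f (upTo n ++ n ∷ []))    ≡⟨ ≡.cong prodL (map-++ f (upTo n) (n ∷ [])) ⟩
    prodL (map f (upTo n) ++ f n ∷ [])  ≈⟨ prodL-snoc (map f (upTo n)) (f n) ⟩
    prodTo n f * f n                    ∎

  -- Sums over signed permutations, by the position of the letter of largest absolute value

  ∑-signedRange : ∀ N f → ∑ (signedRange (suc N)) f ≈ ∑ (signedRange N) f + (f (+ suc N) + f -[1+ N ])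
  ∑-signedRange N f = begin
    ∑ (signedRange (suc N)) f
      ≈⟨ split (suc N) ⟩
    sumTo (suc N) (λ i → f (+ suc i)) + sumTo (suc N) (λ i → f -[1+ i ])
      ≈⟨ +-cong (sumTo-snoc N _) (sumTo-snoc N _) ⟩
    (sumTo N (λ i → f (+ suc i)) + f (+ suc N)) + (sumTo N (λ i → f -[1+ i ]) + f -[1+ N ])
      ≈⟨ +-interchange _ _ _ _ ⟩
    (sumTo N (λ i → f (+ suc i)) + sumTo N (λ i → f -[1+ i ])) + (f (+ suc N) + f -[1+ N ])
      ≈⟨ +-congʳ (split N) ⟨
    ∑ (signedRange N) f + (f (+ suc N) + f -[1+ N ]) ∎
    where
    split : ∀ M → ∑ (signedRange M) f ≈ sumTo M (λ i → f (+ suc i)) + sumTo M (λ i → f -[1+ i ])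
    split M = trans (∑-++ (map (λ i → + suc i) (upTo M)) _ f)
                    (+-cong (∑-map _ (upTo M) f) (∑-map _ (upTo M) f))

  ∑Lists : ℕ → ℕ → (List ℤ → Carrier) → Carrier
  ∑Lists m N = ∑ (allLists m (signedRange N))

  ∑Lists-suc : ∀ m N Ψ → ∑Lists (suc m) N Ψ ≈ ∑ (signedRange N) (λ x → ∑Lists m N (Ψ ∘ (x ∷_)))
  ∑Lists-suc m N Ψ = trans (∑-concatMap _ (signedRange N) Ψ)
                           (∑-cong (signedRange N) (λ x → ∑-map (x ∷_) (allLists m (signedRange N)) Ψ))

  ∑Lists-step : ∀ m N Ψ → ∑Lists (suc m) (suc N) Ψ ≈
    ∑ (signedRange N) (λ x → ∑Lists m (suc N) (Ψ ∘ (x ∷_)))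
      + (∑Lists m (suc N) (Ψ ∘ (+ suc N ∷_)) + ∑Lists m (suc N) (Ψ ∘ (-[1+ N ] ∷_)))
  ∑Lists-step m N Ψ = trans (∑Lists-suc m (suc N) Ψ) (∑-signedRange N _)

  ∑Lists-≈0 : ∀ m N Ψ → (∀ β → Ψ β ≈ 0#) → ∑Lists m N Ψ ≈ 0#
  ∑Lists-≈0 m N Ψ h = trans (∑-cong xs h) (∑-zero xs)
    where xs = allLists m (signedRange N)

  -- The two letters by which the alphabet grows are themselves occurrences of `suc N`, so at each
  -- place their terms vanish.
  ∑Lists-avoiding : ∀ m N Ψ → (∀ β → Occurs (suc N) β → Ψ β ≈ 0#) →
    ∑Lists m (suc N) Ψ ≈ ∑Lists m N Ψ
  ∑Lists-avoiding zero    N Ψ h = refl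
  ∑Lists-avoiding (suc m) N Ψ h = begin
    ∑Lists (suc m) (suc N) Ψ
      ≈⟨ ∑Lists-step m N Ψ ⟩
    ∑ (signedRange N) (λ x → ∑Lists m (suc N) (Ψ ∘ (x ∷_)))
      + (∑Lists m (suc N) (Ψ ∘ (+ suc N ∷_)) + ∑Lists m (suc N) (Ψ ∘ (-[1+ N ] ∷_)))
      ≈⟨ +-cong (∑-cong (signedRange N) (λ x → ∑Lists-avoiding m N _ (λ β → h _ ∘ there)))
                (+-cong (∑Lists-≈0 m (suc N) _ (λ β → h _ (here ≡.refl)))
                        (∑Lists-≈0 m (suc N) _ (λ β → h _ (here ≡.refl)))) ⟩
    ∑ (signedRange N) (λ x → ∑Lists m N (Ψ ∘ (x ∷_))) + (0# + 0#)
      ≈⟨ trans (+-congˡ (+-identityˡ 0#)) (+-identityʳ _) ⟩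
    ∑ (signedRange N) (λ x → ∑Lists m N (Ψ ∘ (x ∷_)))
      ≈⟨ ∑Lists-suc m N Ψ ⟨
    ∑Lists (suc m) N Ψ ∎

  ∑Insert : ℕ → ℤ → (List ℤ → Carrier) → List ℤ → Carrier
  ∑Insert m v Ψ β = sumTo (suc m) (λ j → Ψ (insertAt j v β))

  -- Position 0 puts `v` in front; any later position keeps the first letter `x` and inserts into
  -- the tail.
  ∑Lists-∑Insert : ∀ m N v Ψ → ∑Lists (suc m) N (∑Insert (suc m) v Ψ) ≈
    ∑Lists (suc m) N (Ψ ∘ (v ∷_)) + ∑ (signedRange N) (λ x → ∑Lists m N (∑Insert m v (Ψ ∘ (x ∷_))))
  ∑Lists-∑Insert m N v Ψ = begin
    ∑Lists (suc m) N (∑Insert (suc m) v Ψ)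
      ≈⟨ ∑-cong (allLists (suc m) (signedRange N)) (λ β → sumTo-cons (suc m) _) ⟩
    ∑Lists (suc m) N (λ β → Ψ (v ∷ β) + sumTo (suc m) (λ j → Ψ (insertAt (suc j) v β)))
      ≈⟨ ∑-+ (allLists (suc m) (signedRange N)) _ _ ⟩
    ∑Lists (suc m) N (Ψ ∘ (v ∷_)) + ∑Lists (suc m) N (λ β → sumTo (suc m) (λ j → Ψ (insertAt (suc j) v β)))
      ≈⟨ +-congˡ (∑Lists-suc m N _) ⟩
    ∑Lists (suc m) N (Ψ ∘ (v ∷_)) + ∑ (signedRange N) (λ x → ∑Lists m N (∑Insert m v (Ψ ∘ (x ∷_)))) ∎

  -- A list that can contribute contains a letter of absolute value `suc N` at most once. Without
  -- one it is a list over the smaller range; with one it arises from a shorter list by insertion at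
  -- a single position.
  ∑Lists-insert : ∀ m N Ψ → (∀ β → OccursTwice (suc N) β → Ψ β ≈ 0#) →
    ∑Lists (suc m) (suc N) Ψ ≈
    ∑Lists (suc m) N Ψ + (∑Lists m N (∑Insert m (+ suc N) Ψ) + ∑Lists m N (∑Insert m -[1+ N ] Ψ))
  ∑Lists-insert zero N Ψ h = begin
    ∑Lists 1 (suc N) Ψ
      ≈⟨ ∑Lists-step 0 N Ψ ⟩
    ∑ (signedRange N) (λ x → ∑Lists 0 N (Ψ ∘ (x ∷_)))
      + (∑Lists 0 N (Ψ ∘ (+ suc N ∷_)) + ∑Lists 0 N (Ψ ∘ (-[1+ N ] ∷_)))
      ≈⟨ +-cong (∑Lists-suc 0 N Ψ) (+-cong (+-congʳ (+-identityʳ _)) (+-congʳ (+-identityʳ _))) ⟨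
    ∑Lists 1 N Ψ + (∑Lists 0 N (∑Insert 0 (+ suc N) Ψ) + ∑Lists 0 N (∑Insert 0 -[1+ N ] Ψ)) ∎
  ∑Lists-insert (suc m) N Ψ h = begin
    ∑Lists (suc (suc m)) (suc N) Ψ
      ≈⟨ ∑Lists-step (suc m) N Ψ ⟩
    ∑ (signedRange N) (λ x → ∑Lists (suc m) (suc N) (Ψ ∘ (x ∷_)))
      + (∑Lists (suc m) (suc N) (Ψ ∘ (+ suc N ∷_)) + ∑Lists (suc m) (suc N) (Ψ ∘ (-[1+ N ] ∷_)))
      ≈⟨ +-cong (trans (∑-cong (signedRange N) (λ x → ∑Lists-insert m N (Ψ ∘ (x ∷_)) (λ β → h _ ∘ there)))
                       (trans (∑-+ (signedRange N) _ _) (+-congˡ (∑-+ (signedRange N) _ _))))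
                (+-cong (∑Lists-avoiding (suc m) N _ (λ β → h _ ∘ here ≡.refl))
                        (∑Lists-avoiding (suc m) N _ (λ β → h _ ∘ here ≡.refl))) ⟩
    (∑ (signedRange N) (λ x → ∑Lists (suc m) N (Ψ ∘ (x ∷_))) + (inner (+ suc N) + inner -[1+ N ]))
      + (first (+ suc N) + first -[1+ N ])
      ≈⟨ solve 5 (λ s i⁺ i⁻ f⁺ f⁻ → (s :+ (i⁺ :+ i⁻)) :+ (f⁺ :+ f⁻) := s :+ ((f⁺ :+ i⁺) :+ (f⁻ :+ i⁻)))
           refl _ _ _ _ _ ⟩
    ∑ (signedRange N) (λ x → ∑Lists (suc m) N (Ψ ∘ (x ∷_)))
      + ((first (+ suc N) + inner (+ suc N)) + (first -[1+ N ] + inner -[1+ N ]))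
      ≈⟨ +-cong (∑Lists-suc (suc m) N Ψ) (+-cong (∑Lists-∑Insert m N _ Ψ) (∑Lists-∑Insert m N _ Ψ)) ⟨
    ∑Lists (suc (suc m)) N Ψ + (∑Lists (suc m) N (∑Insert (suc m) (+ suc N) Ψ)
      + ∑Lists (suc m) N (∑Insert (suc m) -[1+ N ] Ψ)) ∎
    where
    first inner : ℤ → Carrier
    first v = ∑Lists (suc m) N (Ψ ∘ (v ∷_))
    inner v = ∑ (signedRange N) (λ x → ∑Lists m N (∑Insert m v (Ψ ∘ (x ∷_))))

  ∑Perms : ℕ → ℕ → (List ℤ → Carrier) → Carrier
  ∑Perms m N = ∑ (signedPerms m N)

  indicated : (List ℤ → Carrier) → List ℤ → Carrier
  indicated Φ β = if absDistinct β then Φ β else 0#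

  ∑Insert-indicated : ∀ m N v Φ → ∣ v ∣ ≡ suc N →
    ∑Lists m N (∑Insert m v (indicated Φ)) ≈ ∑Perms m N (∑Insert m v Φ)
  ∑Insert-indicated m N v Φ ∣v∣≡ = begin
    ∑Lists m N (∑Insert m v (indicated Φ))
      ≈⟨ ∑-cong∈ (allLists m (signedRange N)) (λ {β} β∈ → pull β (proj₂ (∈-allLists⁻ m N β∈))) ⟩
    ∑Lists m N (indicated (∑Insert m v Φ))
      ≈⟨ ∑-filter absDistinct (allLists m (signedRange N)) (∑Insert m v Φ) ⟨
    ∑Perms m N (∑Insert m v Φ) ∎
    where
    pull : ∀ β → All (λ z → ∣ z ∣ < suc N) β → ∑Insert m v (indicated Φ) β ≈ indicated (∑Insert m v Φ) β
    pull β ps = trans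
      (∑-cong (upTo (suc m)) (λ j → reflexive (≡.cong (λ b → if b then Φ (insertAt j v β) else 0#)
        (absDistinct-insertAt j v β (≡.subst (λ u → All (λ z → ∣ z ∣ < u) β) (≡.sym ∣v∣≡) ps)))))
      if-out
      where
      if-out : sumTo (suc m) (λ j → if absDistinct β then Φ (insertAt j v β) else 0#) ≈
               indicated (∑Insert m v Φ) β
      if-out with absDistinct β
      ... | true  = refl
      ... | false = ∑-zero (upTo (suc m))

  ∑Perms-insert : ∀ m N Φ → ∑Perms (suc m) (suc N) Φ ≈
    ∑Perms (suc m) N Φ + (∑Perms m N (∑Insert m (+ suc N) Φ) + ∑Perms m N (∑Insert m -[1+ N ] Φ))
  ∑Perms-insert m N Φ = begin
    ∑Perms (suc m) (suc N) Φ
      ≈⟨ ∑-filter absDistinct (allLists (suc m) (signedRange (suc N))) Φ ⟩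
    ∑Lists (suc m) (suc N) (indicated Φ)
      ≈⟨ ∑Lists-insert m N (indicated Φ) (λ β twice → reflexive
           (≡.cong (λ b → if b then Φ β else 0#) (occursTwice⇒¬absDistinct twice))) ⟩
    ∑Lists (suc m) N (indicated Φ) + (∑Lists m N (∑Insert m (+ suc N) (indicated Φ))
      + ∑Lists m N (∑Insert m -[1+ N ] (indicated Φ)))
      ≈⟨ +-cong (sym (∑-filter absDistinct (allLists (suc m) (signedRange N)) Φ))
                (+-cong (∑Insert-indicated m N _ Φ ≡.refl) (∑Insert-indicated m N _ Φ ≡.refl)) ⟩
    ∑Perms (suc m) N Φ + (∑Perms m N (∑Insert m (+ suc N) Φ) + ∑Perms m N (∑Insert m -[1+ N ] Φ)) ∎

  -- No counting of letters: each term produced by `∑Perms-insert` again has a range below its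
  -- length, and over the empty range there is no nonempty list.
  ∑Perms-pigeonhole : ∀ m N Φ → N < m → ∑Perms m N Φ ≈ 0#
  ∑Perms-pigeonhole (suc m) zero    Φ _         = refl
  ∑Perms-pigeonhole (suc m) (suc N) Φ (s≤s N<m) = begin
    ∑Perms (suc m) (suc N) Φ
      ≈⟨ ∑Perms-insert m N Φ ⟩
    ∑Perms (suc m) N Φ + (∑Perms m N (∑Insert m (+ suc N) Φ) + ∑Perms m N (∑Insert m -[1+ N ] Φ))
      ≈⟨ +-cong (∑Perms-pigeonhole (suc m) N Φ (ℕₚ.m≤n⇒m≤1+n N<m))
                (+-cong (∑Perms-pigeonhole m N _ N<m) (∑Perms-pigeonhole m N _ N<m)) ⟩
    0# + (0# + 0#)
      ≈⟨ trans (+-identityˡ _) (+-identityˡ _) ⟩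
    0# ∎

  ∑Perms-suc : ∀ n Φ → ∑Perms (suc n) (suc n) Φ ≈
    ∑Perms n n (∑Insert n (+ suc n) Φ) + ∑Perms n n (∑Insert n -[1+ n ] Φ)
  ∑Perms-suc n Φ = trans (∑Perms-insert n n Φ)
    (trans (+-congʳ (∑Perms-pigeonhole (suc n) n Φ ℕₚ.≤-refl)) (+-identityˡ _))

  -- Powers and convolutions

  ^-+ : ∀ x m n → x ^ (m ℕ.+ n) ≈ (x ^ m) * (x ^ n)
  ^-+ x zero    n = sym (*-identityˡ _)
  ^-+ x (suc m) n = trans (*-congˡ (^-+ x m n)) (sym (*-assoc _ _ _))

  *-leftComm : ∀ x y z → x * (y * z) ≈ y * (x * z)
  *-leftComm = solve 3 (λ x y z → x :* (y :* z) := y :* (x :* z)) refl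

  ^-distrib-* : ∀ x y n → (x * y) ^ n ≈ (x ^ n) * (y ^ n)
  ^-distrib-* x y zero    = sym (*-identityˡ _)
  ^-distrib-* x y (suc n) = trans (*-congˡ (^-distrib-* x y n))
    (solve 4 (λ a b c d → (a :* b) :* (c :* d) := (a :* c) :* (b :* d)) refl _ _ _ _)

  1^n≈1 : ∀ n → 1# ^ n ≈ 1#
  1^n≈1 zero    = refl
  1^n≈1 (suc n) = trans (*-identityˡ _) (1^n≈1 n)

  ·S-cong : ∀ n {f f′ g g′} → (∀ i → f i ≈ f′ i) → (∀ i → g i ≈ g′ i) → (f ·S g) n ≈ (f′ ·S g′) n
  ·S-cong n hf hg = ∑-cong (upTo (suc n)) (λ i → *-cong (hf i) (hg (n ∸ i)))

  ·S-zero : ∀ f g → (f ·S g) 0 ≈ f 0 * g 0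
  ·S-zero f g = +-identityʳ _

  ·S-sucˡ : ∀ n f g → (f ·S g) (suc n) ≈ f 0 * g (suc n) + ((f ∘ suc) ·S g) n
  ·S-sucˡ n f g = sumTo-cons (suc n) _

  ·S-sucʳ : ∀ n f g → (f ·S g) (suc n) ≈ (f ·S (g ∘ suc)) n + f (suc n) * g 0
  ·S-sucʳ n f g = begin
    (f ·S g) (suc n)
      ≈⟨ sumTo-snoc (suc n) _ ⟩
    sumTo (suc n) (λ i → f i * g (suc n ∸ i)) + f (suc n) * g (n ∸ n)
      ≈⟨ +-cong (sumTo-cong (suc n) (λ { i (s≤s i≤n) → *-congˡ (reflexive (≡.cong g (ℕₚ.+-∸-assoc 1 i≤n))) }))
                (*-congˡ (reflexive (≡.cong g (ℕₚ.n∸n≡0 n)))) ⟩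
    (f ·S (g ∘ suc)) n + f (suc n) * g 0 ∎

  ·S-identityʳ : ∀ n f → (f ·S oneS) n ≈ f n
  ·S-identityʳ zero    f = trans (+-identityʳ _) (*-identityʳ _)
  ·S-identityʳ (suc n) f = begin
    (f ·S oneS) (suc n)
      ≈⟨ ·S-sucʳ n f oneS ⟩
    (f ·S (λ _ → 0#)) n + f (suc n) * 1#
      ≈⟨ +-cong (trans (∑-cong (upTo (suc n)) (λ i → zeroʳ _)) (∑-zero (upTo (suc n)))) (*-identityʳ _) ⟩
    0# + f (suc n)
      ≈⟨ +-identityˡ _ ⟩
    f (suc n) ∎

  -- Substituting c u for u respects products of power series, because the exponents `i` and `n ∸ i`
  -- add up to `n`.
  ·S-scale : ∀ c n f g → ((λ i → (c ^ i) * f i) ·S (λ i → (c ^ i) * g i)) n ≈ (c ^ n) * (f ·S g) n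
  ·S-scale c n f g = trans
    (sumTo-cong (suc n) (λ { i (s≤s i≤n) → begin
      ((c ^ i) * f i) * ((c ^ (n ∸ i)) * g (n ∸ i))
        ≈⟨ solve 4 (λ x y z w → (x :* y) :* (z :* w) := (x :* z) :* (y :* w)) refl _ _ _ _ ⟩
      ((c ^ i) * (c ^ (n ∸ i))) * (f i * g (n ∸ i))
        ≈⟨ *-congʳ (^-+ c i (n ∸ i)) ⟨
      (c ^ (i ℕ.+ (n ∸ i))) * (f i * g (n ∸ i))
        ≡⟨ ≡.cong (λ m → (c ^ m) * (f i * g (n ∸ i))) (ℕₚ.m+[n∸m]≡n i≤n) ⟩
      (c ^ n) * (f i * g (n ∸ i)) ∎ }))
    (sym (*-∑ (upTo (suc n)) _ _))

  prodS-scale : ∀ c n {A : Set} (js : List A) (f g : A → PS) → (∀ j i → f j i ≈ (c ^ i) * g j i) →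
    prodS (map f js) n ≈ (c ^ n) * prodS (map g js) n
  prodS-scale c zero    []       f g h = sym (*-identityˡ _)
  prodS-scale c (suc n) []       f g h = sym (zeroʳ _)
  prodS-scale c n       (j ∷ js) f g h =
    trans (·S-cong n (h j) (λ i → prodS-scale c i js f g h)) (·S-scale c n (g j) (prodS (map g js)))

  -- Multiplication by the `d`-th power of the variable.
  shift : ℕ → PS → PS
  shift zero    f k       = f k
  shift (suc d) f zero    = 0#
  shift (suc d) f (suc k) = shift d f k

  ·S-monomial : ∀ d v f k → (f ·S (λ i → if d ≡ᵇ i then v else 0#)) k ≈ shift d f k * v
  ·S-monomial zero    v f zero    = +-identityʳ _
  ·S-monomial zero    v f (suc k) = begin
    (f ·S (λ i → if 0 ≡ᵇ i then v else 0#)) (suc k)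
      ≈⟨ ·S-sucʳ k f (λ i → if 0 ≡ᵇ i then v else 0#) ⟩
    (f ·S (λ _ → 0#)) k + f (suc k) * v
      ≈⟨ +-congʳ (trans (∑-cong (upTo (suc k)) (λ i → zeroʳ _)) (∑-zero (upTo (suc k)))) ⟩
    0# + f (suc k) * v
      ≈⟨ +-identityˡ _ ⟩
    f (suc k) * v ∎
  ·S-monomial (suc d) v f zero    = trans (+-identityʳ _) (trans (zeroʳ _) (sym (zeroˡ _)))
  ·S-monomial (suc d) v f (suc k) = begin
    (f ·S (λ i → if suc d ≡ᵇ i then v else 0#)) (suc k)
      ≈⟨ ·S-sucʳ k f (λ i → if suc d ≡ᵇ i then v else 0#) ⟩
    (f ·S (λ i → if d ≡ᵇ i then v else 0#)) k + f (suc k) * 0#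
      ≈⟨ +-cong (·S-monomial d v f k) (zeroʳ _) ⟩
    shift d f k * v + 0#
      ≈⟨ +-identityʳ _ ⟩
    shift d f k * v ∎

  -- Chains of colours along a word

  -- `s` tells whether there is a descent. The bound is exclusive, to suit `sumTo`: the next colour
  -- is below `k` at a descent and at most `k` otherwise.
  bound : Bool → ℕ → ℕ
  bound s k = if s then k else suc k

  -- The sum of ∏ᵢ x cᵢ over the sequences k = c₀ ≥ c₁ ≥ … ≥ 0 which decrease strictly at
  -- the descents of y ∷ zs.
  chains : (ℕ → Carrier) → ℤ → List ℤ → ℕ → Carrier
  chains x y []       k = 1#
  chains x y (z ∷ zs) k = sumTo (bound (y >ᵇ z) k) (λ c → x c * chains x z zs c)

  bound-≤ : ∀ s {c k} → c < bound s k → c ≤ k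
  bound-≤ true  c<k       = ℕₚ.<⇒≤ c<k
  bound-≤ false (s≤s c≤k) = c≤k

  -- Colours never increase along the word, so only the values of `x` up to `k` enter. This allows a
  -- partial scaling to be replaced by a full one, or by none, inside a tail.
  chains-cong : ∀ {x x′} y zs k → (∀ c → c ≤ k → x c ≈ x′ c) → chains x y zs k ≈ chains x′ y zs k
  chains-cong y []       k h = refl
  chains-cong y (z ∷ zs) k h = sumTo-cong (bound (y >ᵇ z) k) (λ c c<b →
    let c≤k = bound-≤ (y >ᵇ z) c<b in
    *-cong (h c c≤k) (chains-cong z zs c (λ d d≤c → h d (ℕₚ.≤-trans d≤c c≤k))))

  chains-scale : ∀ p x y zs k → chains (λ c → p * x c) y zs k ≈ (p ^ length zs) * chains x y zs k
  chains-scale p x y []       k = sym (*-identityʳ _)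
  chains-scale p x y (z ∷ zs) k = trans
    (∑-cong (upTo (bound (y >ᵇ z) k)) (λ c → trans (*-congˡ (chains-scale p x z zs c))
      (solve 4 (λ a b d e → (a :* b) :* (d :* e) := (a :* d) :* (b :* e)) refl _ _ _ _)))
    (sym (*-∑ (upTo (bound (y >ᵇ z) k)) _ _))

  sumTo-snoc₂ : ∀ m n (f : ℕ → ℕ → Carrier) → sumTo m (λ c → sumTo (suc n) (f c)) ≈
    sumTo m (λ c → sumTo n (f c)) + sumTo m (λ c → f c n)
  sumTo-snoc₂ m n f = trans (∑-cong (upTo m) (λ c → sumTo-snoc n (f c))) (∑-+ (upTo m) _ _)

  sumTo-square : ∀ n (f : ℕ → ℕ → Carrier) → sumTo n (λ c → sumTo n (f c)) ≈
    sumTo n (λ c → sumTo c (f c)) + sumTo n (λ d → sumTo (suc d) (λ c → f c d))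
  sumTo-square zero    f = sym (+-identityˡ _)
  sumTo-square (suc n) f = begin
    sumTo (suc n) (λ c → sumTo (suc n) (f c))
      ≈⟨ sumTo-snoc₂ (suc n) n f ⟩
    sumTo (suc n) (λ c → sumTo n (f c)) + column
      ≈⟨ +-congʳ (sumTo-snoc n _) ⟩
    (sumTo n (λ c → sumTo n (f c)) + sumTo n (f n)) + column
      ≈⟨ +-congʳ (+-congʳ (sumTo-square n f)) ⟩
    ((sumTo n (λ c → sumTo c (f c)) + sumTo n (λ d → sumTo (suc d) (λ c → f c d))) + sumTo n (f n)) + column
      ≈⟨ solve 4 (λ a b c d → ((a :+ b) :+ c) :+ d := (a :+ c) :+ (b :+ d)) refl _ _ _ _ ⟩
    (sumTo n (λ c → sumTo c (f c)) + sumTo n (f n))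
      + (sumTo n (λ d → sumTo (suc d) (λ c → f c d)) + column)
      ≈⟨ +-cong (sumTo-snoc n _) (sumTo-snoc n _) ⟨
    sumTo (suc n) (λ c → sumTo c (f c)) + sumTo (suc n) (λ d → sumTo (suc d) (λ c → f c d)) ∎
    where column = sumTo (suc n) (λ c → f c n)

  -- Here `c` is the colour of an inserted maximum and `d` that of the first letter. For `d < c` the
  -- maximum stands in front, for `c ≤ d` it comes later. If `s` is `true`, the row `c = k` has only
  -- `d < k` and belongs wholly to the first triangle.
  sumTo-triangles : ∀ s k (f : ℕ → ℕ → Carrier) → sumTo (suc k) (λ c → sumTo (bound s k) (f c)) ≈
    sumTo (suc k) (λ c → sumTo c (f c)) + sumTo (bound s k) (λ d → sumTo (suc d) (λ c → f c d))
  sumTo-triangles false k f = sumTo-square (suc k) f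
  sumTo-triangles true  k f = begin
    sumTo (suc k) (λ c → sumTo k (f c))
      ≈⟨ sumTo-snoc k _ ⟩
    sumTo k (λ c → sumTo k (f c)) + sumTo k (f k)
      ≈⟨ +-congʳ (sumTo-square k f) ⟩
    (sumTo k (λ c → sumTo c (f c)) + sumTo k (λ d → sumTo (suc d) (λ c → f c d))) + sumTo k (f k)
      ≈⟨ solve 3 (λ a b c → (a :+ b) :+ c := (a :+ c) :+ b) refl _ _ _ ⟩
    (sumTo k (λ c → sumTo c (f c)) + sumTo k (f k)) + sumTo k (λ d → sumTo (suc d) (λ c → f c d))
      ≈⟨ +-congʳ (sumTo-snoc k _) ⟨
    sumTo (suc k) (λ c → sumTo c (f c)) + sumTo k (λ d → sumTo (suc d) (λ c → f c d)) ∎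

  -- The version for an inserted minimum, which stands in front exactly when `d ≤ c`. Exchanging `c`
  -- and `d` leads back to the previous two splittings.
  sumTo-triangles′ : ∀ s k (f : ℕ → ℕ → Carrier) → sumTo k (λ c → sumTo (bound s k) (f c)) ≈
    sumTo k (λ c → sumTo (suc c) (f c)) + sumTo (bound s k) (λ d → sumTo d (λ c → f c d))
  sumTo-triangles′ s k f = trans (∑-swap (upTo k) (upTo (bound s k)) f) (trans (transposed s) (+-comm _ _))
    where
    transposed : ∀ s → sumTo (bound s k) (λ d → sumTo k (λ c → f c d)) ≈
      sumTo (bound s k) (λ d → sumTo d (λ c → f c d)) + sumTo k (λ c → sumTo (suc c) (f c))
    transposed false = sumTo-triangles true k (λ d c → f c d)
    transposed true  = sumTo-square k (λ d c → f c d)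

  -- Inserting an extremal letter into a coloured word

  module Statistics (p a : Carrier) where

    -- One factor `p` for each letter inverted with an inserted letter of colour `c`: those after a
    -- maximum, or those before a minimum. Both tests are strict, since letters of colour `c` itself
    -- lie on the side without inversions.
    scaleBelow scaleAbove : ℕ → (ℕ → Carrier) → ℕ → Carrier
    scaleBelow c x j = if j <ᵇ c then p * x j else x j
    scaleAbove c x j = if c <ᵇ j then p * x j else x j

    scaleBelow-< : ∀ {c j} x → j < c → scaleBelow c x j ≈ p * x j
    scaleBelow-< {c} {j} x j<c =
      reflexive (≡.cong (λ b → if b then p * x j else x j) (<⇒<ᵇ≡true j<c))

    scaleBelow-≥ : ∀ {c j} x → c ≤ j → scaleBelow c x j ≈ x j
    scaleBelow-≥ {c} {j} x c≤j =
      reflexive (≡.cong (λ b → if b then p * x j else x j) (≤⇒<ᵇ≡false c≤j))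

    scaleAbove-> : ∀ {c j} x → c < j → scaleAbove c x j ≈ p * x j
    scaleAbove-> {c} {j} x c<j =
      reflexive (≡.cong (λ b → if b then p * x j else x j) (<⇒<ᵇ≡true c<j))

    scaleAbove-≤ : ∀ {c j} x → j ≤ c → scaleAbove c x j ≈ x j
    scaleAbove-≤ {c} {j} x j≤c =
      reflexive (≡.cong (λ b → if b then p * x j else x j) (≤⇒<ᵇ≡false j≤c))

    chains-∷-≺ : ∀ x y v zs k → y ≺ v →
      chains x y (v ∷ zs) k ≈ sumTo (suc k) (λ c → x c * chains x v zs c)
    chains-∷-≺ x y v zs k y≺v =
      reflexive (≡.cong (λ s → sumTo (bound s k) (λ c → x c * chains x v zs c)) (proj₁ y≺v))

    chains-∷-≻ : ∀ x y v zs k → v ≺ y →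
      chains x y (v ∷ zs) k ≈ sumTo k (λ c → x c * chains x v zs c)
    chains-∷-≻ x y v zs k v≺y =
      reflexive (≡.cong (λ s → sumTo (bound s k) (λ c → x c * chains x v zs c)) (proj₂ v≺y))

    -- A chain along zs extends to the colour c of the inserted maximum v at exactly one
    -- position, and the letters to the right of v are then those coloured below c.
    chains-insert-max : ∀ x y v zs k → y ≺ v → All (_≺ v) zs →
      sumTo (suc (length zs)) (λ j → (p ^ (length zs ∸ j)) * chains x y (insertAt j v zs) k) ≈
      sumTo (suc k) (λ c → x c * chains (scaleBelow c x) y zs k)
    chains-insert-max x y v [] k y≺v [] =
      trans (+-identityʳ _) (trans (*-identityˡ _) (chains-∷-≺ x y v [] k y≺v))
    chains-insert-max x y v (z ∷ zs) k y≺v (z≺v ∷ ps) = begin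
      sumTo (suc (suc (length zs)))
        (λ j → (p ^ (suc (length zs) ∸ j)) * chains x y (insertAt j v (z ∷ zs)) k)
        ≈⟨ sumTo-cons (suc (length zs)) _ ⟩
      (p ^ suc (length zs)) * chains x y (v ∷ z ∷ zs) k
        + sumTo (suc (length zs)) (λ j → (p ^ (length zs ∸ j)) *
            sumTo b (λ d → x d * chains x z (insertAt j v zs) d))
        ≈⟨ +-cong v-first v-later ⟩
      sumTo (suc k) (λ c → sumTo c (f c)) + sumTo b (λ d → sumTo (suc d) (λ c → f c d))
        ≈⟨ sumTo-triangles (y >ᵇ z) k f ⟨
      sumTo (suc k) (λ c → sumTo b (f c))
        ≈⟨ ∑-cong (upTo (suc k)) (λ c → sym (*-∑ (upTo b) _ _)) ⟩
      sumTo (suc k) (λ c → x c * chains (scaleBelow c x) y (z ∷ zs) k) ∎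
      where
      b = bound (y >ᵇ z) k
      f : ℕ → ℕ → Carrier
      f c d = x c * (scaleBelow c x d * chains (scaleBelow c x) z zs d)

      -- With `v` in front, `z` and all letters of `zs` have colours below `c`. All their variables
      -- are scaled, which accounts for one `p` per letter.
      below : ∀ c d → d < c → (p ^ suc (length zs)) * (x c * (x d * chains x z zs d)) ≈ f c d
      below c d d<c = begin
        (p * (p ^ length zs)) * (x c * (x d * chains x z zs d))
          ≈⟨ solve 5 (λ p pl xc xd g → (p :* pl) :* (xc :* (xd :* g)) := xc :* ((p :* xd) :* (pl :* g)))
               refl _ _ _ _ _ ⟩
        x c * ((p * x d) * ((p ^ length zs) * chains x z zs d))
          ≈⟨ *-congˡ (*-cong (scaleBelow-< x d<c) (trans
               (chains-cong z zs d (λ e e≤d → scaleBelow-< x (ℕₚ.≤-<-trans e≤d d<c)))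
               (chains-scale p x z zs d))) ⟨
        f c d ∎

      v-first : (p ^ suc (length zs)) * chains x y (v ∷ z ∷ zs) k ≈ sumTo (suc k) (λ c → sumTo c (f c))
      v-first = begin
        (p ^ suc (length zs)) * chains x y (v ∷ z ∷ zs) k
          ≈⟨ *-congˡ (chains-∷-≺ x y v (z ∷ zs) k y≺v) ⟩
        (p ^ suc (length zs)) * sumTo (suc k) (λ c → x c * chains x v (z ∷ zs) c)
          ≈⟨ *-∑ (upTo (suc k)) _ _ ⟩
        sumTo (suc k) (λ c → (p ^ suc (length zs)) * (x c * chains x v (z ∷ zs) c))
          ≈⟨ ∑-cong (upTo (suc k)) (λ c → trans
               (*-congˡ (trans (*-congˡ (chains-∷-≻ x v z zs c z≺v)) (*-∑ (upTo c) _ _)))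
               (trans (*-∑ (upTo c) _ _) (sumTo-cong c (below c)))) ⟩
        sumTo (suc k) (λ c → sumTo c (f c)) ∎

      -- With `v` behind `z`, its colour is at most the colour `d` of `z`. Hence `x d` stays
      -- unscaled, and the induction hypothesis applies with `z` as predecessor.
      v-later : sumTo (suc (length zs)) (λ j → (p ^ (length zs ∸ j)) *
                  sumTo b (λ d → x d * chains x z (insertAt j v zs) d)) ≈
                sumTo b (λ d → sumTo (suc d) (λ c → f c d))
      v-later = begin
        sumTo (suc (length zs)) (λ j → (p ^ (length zs ∸ j)) *
          sumTo b (λ d → x d * chains x z (insertAt j v zs) d))
          ≈⟨ ∑-cong (upTo (suc (length zs))) (λ j → trans (*-∑ (upTo b) _ _)
               (∑-cong (upTo b) (λ d → *-leftComm _ _ _))) ⟩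
        sumTo (suc (length zs)) (λ j → sumTo b (λ d →
          x d * ((p ^ (length zs ∸ j)) * chains x z (insertAt j v zs) d)))
          ≈⟨ ∑-swap (upTo (suc (length zs))) (upTo b) _ ⟩
        sumTo b (λ d → sumTo (suc (length zs)) (λ j →
          x d * ((p ^ (length zs ∸ j)) * chains x z (insertAt j v zs) d)))
          ≈⟨ ∑-cong (upTo b) (λ d → trans (sym (*-∑ (upTo (suc (length zs))) _ _))
               (trans (*-congˡ (chains-insert-max x z v zs d z≺v ps))
               (trans (*-∑ (upTo (suc d)) _ _)
               (sumTo-cong (suc d) (λ { c (s≤s c≤d) →
                 trans (*-leftComm _ _ _) (*-congˡ (*-congʳ (sym (scaleBelow-≥ x c≤d)))) }))))) ⟩
        sumTo b (λ d → sumTo (suc d) (λ c → f c d)) ∎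

    -- A step down to the minimum is a descent, so the letters before it have colours above `c` and
    -- `c` itself is below `k`. The step up after it allows equality: the letters that follow have
    -- colours at most `c`.
    chains-insert-min : ∀ x y v zs k → v ≺ y → All (v ≺_) zs →
      sumTo (suc (length zs)) (λ j → (p ^ j) * chains x y (insertAt j v zs) k) ≈
      sumTo k (λ c → x c * chains (scaleAbove c x) y zs k)
    chains-insert-min x y v [] k v≺y [] =
      trans (+-identityʳ _) (trans (*-identityˡ _) (chains-∷-≻ x y v [] k v≺y))
    chains-insert-min x y v (z ∷ zs) k v≺y (v≺z ∷ ps) = begin
      sumTo (suc (suc (length zs))) (λ j → (p ^ j) * chains x y (insertAt j v (z ∷ zs)) k)
        ≈⟨ sumTo-cons (suc (length zs)) _ ⟩
      1# * chains x y (v ∷ z ∷ zs) k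
        + sumTo (suc (length zs)) (λ j → (p ^ suc j) * sumTo b (λ d → x d * chains x z (insertAt j v zs) d))
        ≈⟨ +-cong v-first v-later ⟩
      sumTo k (λ c → sumTo (suc c) (f c)) + sumTo b (λ d → sumTo d (λ c → f c d))
        ≈⟨ sumTo-triangles′ (y >ᵇ z) k f ⟨
      sumTo k (λ c → sumTo b (f c))
        ≈⟨ ∑-cong (upTo k) (λ c → sym (*-∑ (upTo b) _ _)) ⟩
      sumTo k (λ c → x c * chains (scaleAbove c x) y (z ∷ zs) k) ∎
      where
      b = bound (y >ᵇ z) k
      f : ℕ → ℕ → Carrier
      f c d = x c * (scaleAbove c x d * chains (scaleAbove c x) z zs d)

      v-first : 1# * chains x y (v ∷ z ∷ zs) k ≈ sumTo k (λ c → sumTo (suc c) (f c))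
      v-first = begin
        1# * chains x y (v ∷ z ∷ zs) k
          ≈⟨ trans (*-identityˡ _) (chains-∷-≻ x y v (z ∷ zs) k v≺y) ⟩
        sumTo k (λ c → x c * chains x v (z ∷ zs) c)
          ≈⟨ ∑-cong (upTo k) (λ c → trans (*-congˡ (chains-∷-≺ x v z zs c v≺z)) (trans (*-∑ (upTo (suc c)) _ _)
               (sumTo-cong (suc c) (λ { d (s≤s d≤c) → *-congˡ (*-cong (sym (scaleAbove-≤ x d≤c))
                 (chains-cong z zs d (λ e e≤d → sym (scaleAbove-≤ x (ℕₚ.≤-trans e≤d d≤c))))) })))) ⟩
        sumTo k (λ c → sumTo (suc c) (f c)) ∎

      v-later : sumTo (suc (length zs)) (λ j → (p ^ suc j) * sumTo b (λ d → x d * chains x z (insertAt j v zs) d)) ≈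
                sumTo b (λ d → sumTo d (λ c → f c d))
      v-later = begin
        sumTo (suc (length zs)) (λ j → (p ^ suc j) * sumTo b (λ d → x d * chains x z (insertAt j v zs) d))
          ≈⟨ ∑-cong (upTo (suc (length zs))) (λ j → trans (*-∑ (upTo b) _ _)
               -- One `p` of `p ^ suc j` is the inversion of `z` with `v`; it becomes the scaling of
               -- `x d`.
               (∑-cong (upTo b) (λ d → solve 4 (λ p pj xd g → (p :* pj) :* (xd :* g) := (p :* xd) :* (pj :* g))
                 refl _ _ _ _))) ⟩
        sumTo (suc (length zs)) (λ j → sumTo b (λ d →
          (p * x d) * ((p ^ j) * chains x z (insertAt j v zs) d)))
          ≈⟨ ∑-swap (upTo (suc (length zs))) (upTo b) _ ⟩
        sumTo b (λ d → sumTo (suc (length zs)) (λ j →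
          (p * x d) * ((p ^ j) * chains x z (insertAt j v zs) d)))
          ≈⟨ ∑-cong (upTo b) (λ d → trans (sym (*-∑ (upTo (suc (length zs))) _ _))
               (trans (*-congˡ (chains-insert-min x z v zs d v≺z ps))
               (trans (*-∑ (upTo d) _ _)
               (sumTo-cong d (λ c c<d →
                 trans (*-leftComm _ _ _) (*-congˡ (*-congʳ (sym (scaleAbove-> x c<d))))))))) ⟩
        sumTo b (λ d → sumTo d (λ c → f c d)) ∎

    -- The recurrence for coloured sums over signed permutations

    weight : List ℤ → Carrier
    weight β = (p ^ ℓB β) * (a ^ negStat β)

    weight-insert-max : ∀ N j β → All (λ z → ∣ z ∣ < suc N) β →
      weight (insertAt j (+ suc N) β) ≈ (p ^ (length β ∸ j)) * weight β
    weight-insert-max N j β ps = begin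
      weight (insertAt j (+ suc N) β)
        ≡⟨ ≡.cong₂ (λ l m → (p ^ l) * (a ^ m)) ℓB-insert (negStat-insertAt j (+ suc N) β) ⟩
      (p ^ ((length β ∸ j) ℕ.+ ℓB β)) * (a ^ negStat β)
        ≈⟨ *-congʳ (^-+ p (length β ∸ j) (ℓB β)) ⟩
      ((p ^ (length β ∸ j)) * (p ^ ℓB β)) * (a ^ negStat β)
        ≈⟨ *-assoc _ _ _ ⟩
      (p ^ (length β ∸ j)) * weight β ∎
      where
      ℓB-insert : ℓB (insertAt j (+ suc N) β) ≡ (length β ∸ j) ℕ.+ ℓB β
      ℓB-insert = ≡.trans
        (≡.cong₂ ℕ._+_ (inv-insertAt-max j (+ suc N) β (All.map (λ {z} → ∣z∣<v⇒z≺+v N z) ps))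
                       (negSum-insertAt j (+ suc N) β))
        (ℕₚ.+-assoc (length β ∸ j) (inv β) (negSum β))

    -- The constant combines the new sign with the growth of `negSum` by the absolute value `suc N`;
    -- `p ^ j` is the growth of `inv`.
    weight-insert-min : ∀ N j β → j ≤ length β → All (λ z → ∣ z ∣ < suc N) β →
      weight (insertAt j -[1+ N ] β) ≈ (a * (p ^ suc N)) * ((p ^ j) * weight β)
    weight-insert-min N j β j≤ ps = begin
      weight (insertAt j -[1+ N ] β)
        ≡⟨ ≡.cong₂ (λ l m → (p ^ l) * (a ^ m))
             (≡.cong₂ ℕ._+_ (inv-insertAt-min j -[1+ N ] β j≤ (All.map (λ {z} → ∣z∣<v⇒-v≺z N z) ps))
                            (negSum-insertAt j -[1+ N ] β))
             (negStat-insertAt j -[1+ N ] β) ⟩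
      (p ^ ((j ℕ.+ inv β) ℕ.+ (suc N ℕ.+ negSum β))) * (a * (a ^ negStat β))
        ≈⟨ *-congʳ (trans (^-+ p (j ℕ.+ inv β) _) (*-cong (^-+ p j (inv β)) (^-+ p (suc N) (negSum β)))) ⟩
      (((p ^ j) * (p ^ inv β)) * ((p ^ suc N) * (p ^ negSum β))) * (a * (a ^ negStat β))
        ≈⟨ solve 6 (λ pj pi pN ps a am → ((pj :* pi) :* (pN :* ps)) :* (a :* am) :=
                                         (a :* pN) :* (pj :* ((pi :* ps) :* am))) refl _ _ _ _ _ _ ⟩
      (a * (p ^ suc N)) * ((p ^ j) * (((p ^ inv β) * (p ^ negSum β)) * (a ^ negStat β)))
        ≈⟨ *-congˡ (*-congˡ (*-congʳ (^-+ p (inv β) (negSum β)))) ⟨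
      (a * (p ^ suc N)) * ((p ^ j) * weight β) ∎

    weightedChains : (ℕ → Carrier) → ℕ → List ℤ → Carrier
    weightedChains x k β = weight β * chains x (+ 0) β k

    ∑Insert-max : ∀ n x k β → Bounded n n β → ∑Insert n (+ suc n) (weightedChains x k) β ≈
      sumTo (suc k) (λ c → x c * weightedChains (scaleBelow c x) k β)
    ∑Insert-max n x k β (len , ps) = begin
      sumTo (suc n) (λ j → weight (insertAt j (+ suc n) β) * chains x (+ 0) (insertAt j (+ suc n) β) k)
        ≈⟨ ∑-cong (upTo (suc n)) (λ j → trans (*-congʳ (weight-insert-max n j β ps))
             (solve 3 (λ pj w g → (pj :* w) :* g := w :* (pj :* g)) refl _ _ _)) ⟩
      sumTo (suc n) (λ j → weight β * ((p ^ (length β ∸ j)) * chains x (+ 0) (insertAt j (+ suc n) β) k))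
        ≈⟨ *-∑ (upTo (suc n)) _ _ ⟨
      weight β * sumTo (suc n) (λ j → (p ^ (length β ∸ j)) * chains x (+ 0) (insertAt j (+ suc n) β) k)
        ≡⟨ ≡.cong (λ m → weight β * sumTo (suc m)
             (λ j → (p ^ (length β ∸ j)) * chains x (+ 0) (insertAt j (+ suc n) β) k)) (≡.sym len) ⟩
      weight β * sumTo (suc (length β))
        (λ j → (p ^ (length β ∸ j)) * chains x (+ 0) (insertAt j (+ suc n) β) k)
        ≈⟨ *-congˡ (chains-insert-max x (+ 0) (+ suc n) β k (∣z∣<v⇒z≺+v n (+ 0) (s≤s z≤n))
             (All.map (λ {z} → ∣z∣<v⇒z≺+v n z) ps)) ⟩
      weight β * sumTo (suc k) (λ c → x c * chains (scaleBelow c x) (+ 0) β k)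
        ≈⟨ *-∑ (upTo (suc k)) _ _ ⟩
      sumTo (suc k) (λ c → weight β * (x c * chains (scaleBelow c x) (+ 0) β k))
        ≈⟨ ∑-cong (upTo (suc k)) (λ c → *-leftComm _ _ _) ⟩
      sumTo (suc k) (λ c → x c * weightedChains (scaleBelow c x) k β) ∎

    ∑Insert-min : ∀ n x k β → Bounded n n β → ∑Insert n -[1+ n ] (weightedChains x k) β ≈
      (a * (p ^ suc n)) * sumTo k (λ c → x c * weightedChains (scaleAbove c x) k β)
    ∑Insert-min n x k β (len , ps) = begin
      sumTo (suc n) (λ j → weight (insertAt j -[1+ n ] β) * chains x (+ 0) (insertAt j -[1+ n ] β) k)
        ≈⟨ sumTo-cong (suc n) (λ { j (s≤s j≤n) → trans
             (*-congʳ (weight-insert-min n j β (≡.subst (j ≤_) (≡.sym len) j≤n) ps))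
             (solve 4 (λ apn pj w g → (apn :* (pj :* w)) :* g := (apn :* w) :* (pj :* g)) refl _ _ _ _) }) ⟩
      sumTo (suc n) (λ j → ((a * (p ^ suc n)) * weight β) * ((p ^ j) * chains x (+ 0) (insertAt j -[1+ n ] β) k))
        ≈⟨ *-∑ (upTo (suc n)) _ _ ⟨
      ((a * (p ^ suc n)) * weight β) * sumTo (suc n) (λ j → (p ^ j) * chains x (+ 0) (insertAt j -[1+ n ] β) k)
        ≡⟨ ≡.cong (λ m → ((a * (p ^ suc n)) * weight β) * sumTo (suc m)
             (λ j → (p ^ j) * chains x (+ 0) (insertAt j -[1+ n ] β) k)) (≡.sym len) ⟩
      ((a * (p ^ suc n)) * weight β) *
        sumTo (suc (length β)) (λ j → (p ^ j) * chains x (+ 0) (insertAt j -[1+ n ] β) k)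
        ≈⟨ *-congˡ (chains-insert-min x (+ 0) -[1+ n ] β k (∣z∣<v⇒-v≺z n (+ 0) (s≤s z≤n))
             (All.map (λ {z} → ∣z∣<v⇒-v≺z n z) ps)) ⟩
      ((a * (p ^ suc n)) * weight β) * sumTo k (λ c → x c * chains (scaleAbove c x) (+ 0) β k)
        ≈⟨ trans (*-assoc _ _ _) (*-congˡ (trans (*-∑ (upTo k) _ _)
             (∑-cong (upTo k) (λ c → *-leftComm _ _ _)))) ⟩
      (a * (p ^ suc n)) * sumTo k (λ c → x c * weightedChains (scaleAbove c x) k β) ∎

    -- The quantity Aₙ(x) of the overview, with `k` as the colour of β(0).
    colouredSum : ℕ → (ℕ → Carrier) → ℕ → Carrier
    colouredSum n x k = ∑Perms n n (weightedChains x k)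

    ∑Perms-sumTo : ∀ n m (x : ℕ → Carrier) (Φ : ℕ → List ℤ → Carrier) →
      ∑Perms n n (λ β → sumTo m (λ c → x c * Φ c β)) ≈ sumTo m (λ c → x c * ∑Perms n n (Φ c))
    ∑Perms-sumTo n m x Φ = trans (∑-swap (signedPerms n n) (upTo m) _)
      (∑-cong (upTo m) (λ c → sym (*-∑ (signedPerms n n) _ _)))

    colouredSum-suc : ∀ n x k → colouredSum (suc n) x k ≈
      sumTo (suc k) (λ c → x c * colouredSum n (scaleBelow c x) k)
        + (a * (p ^ suc n)) * sumTo k (λ c → x c * colouredSum n (scaleAbove c x) k)
    colouredSum-suc n x k = begin
      colouredSum (suc n) x k
        ≈⟨ ∑Perms-suc n (weightedChains x k) ⟩
      ∑Perms n n (∑Insert n (+ suc n) (weightedChains x k)) + ∑Perms n n (∑Insert n -[1+ n ] (weightedChains x k))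
        ≈⟨ +-cong (∑-cong∈ (signedPerms n n) (λ {β} β∈ → ∑Insert-max n x k β (∈-signedPerms⁻ n n β∈)))
                  (trans (∑-cong∈ (signedPerms n n) (λ {β} β∈ → ∑Insert-min n x k β (∈-signedPerms⁻ n n β∈)))
                         (sym (*-∑ (signedPerms n n) _ _))) ⟩
      ∑Perms n n (λ β → sumTo (suc k) (λ c → x c * weightedChains (scaleBelow c x) k β))
        + (a * (p ^ suc n)) * ∑Perms n n (λ β → sumTo k (λ c → x c * weightedChains (scaleAbove c x) k β))
        ≈⟨ +-cong (∑Perms-sumTo n (suc k) x _) (*-congˡ (∑Perms-sumTo n k x _)) ⟩
      sumTo (suc k) (λ c → x c * colouredSum n (scaleBelow c x) k)
        + (a * (p ^ suc n)) * sumTo k (λ c → x c * colouredSum n (scaleAbove c x) k) ∎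

    -- The product of q-exponentials

    module Exponentials (invQ invN : ℕ → Carrier)
      (invQ-inverse : ∀ m → qint p (suc m) * invQ m ≈ 1#)
      (invN-inverse : ∀ i → (1# + a * (p ^ suc i)) * invN i ≈ 1#) where

      -- The product in `rhsCoeff` for arbitrary `x`, built so that colour 0 can be split off and
      -- the rest is the same product for `x ∘ suc`.
      expProduct : (ℕ → Carrier) → ℕ → PS
      expProduct x zero    = ehatS invQ invN (x 0)
      expProduct x (suc k) = eS invQ (x 0) ·S expProduct (x ∘ suc) k

      -- The p-derivative of e[x u] is x e[x u], read off coefficientwise.
      eS-suc : ∀ x n → qint p (suc n) * eS invQ x (suc n) ≈ x * eS invQ x n
      eS-suc x n = begin
        qint p (suc n) * ((x * (x ^ n)) * invFact invQ (suc n))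
          ≈⟨ *-congˡ (*-congˡ (prodTo-snoc n invQ)) ⟩
        qint p (suc n) * ((x * (x ^ n)) * (invFact invQ n * invQ n))
          ≈⟨ solve 5 (λ b x xn f i → b :* ((x :* xn) :* (f :* i)) := (x :* (xn :* f)) :* (b :* i))
               refl _ _ _ _ _ ⟩
        (x * eS invQ x n) * (qint p (suc n) * invQ n)
          ≈⟨ trans (*-congˡ (invQ-inverse n)) (*-identityʳ _) ⟩
        x * eS invQ x n ∎

      invHatFact-suc : ∀ n → invHatFact invQ invN (suc n) ≈ (invN n * invQ n) * invHatFact invQ invN n
      invHatFact-suc n = trans (*-cong (prodTo-snoc n invN) (prodTo-snoc n invQ))
        (solve 4 (λ a b c d → (a :* b) :* (c :* d) := (b :* d) :* (a :* c)) refl _ _ _ _)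

      -- For positive `n`, the quotient of two consecutive hatted factorials. It replaces [n]_p so
      -- that the last factor of the product obeys a rule like `eS-suc`.
      factor : ℕ → Carrier
      factor n = (1# + a * (p ^ n)) * qint p n

      factor-inverse : ∀ n → (invN n * invQ n) * factor (suc n) ≈ 1#
      factor-inverse n = begin
        (invN n * invQ n) * ((1# + a * (p ^ suc n)) * qint p (suc n))
          ≈⟨ solve 4 (λ a b c d → (a :* b) :* (c :* d) := (c :* a) :* (d :* b)) refl _ _ _ _ ⟩
        ((1# + a * (p ^ suc n)) * invN n) * (qint p (suc n) * invQ n)
          ≈⟨ trans (*-cong (invN-inverse n) (invQ-inverse n)) (*-identityˡ _) ⟩
        1# ∎

      ehatS-suc : ∀ x n → factor (suc n) * ehatS invQ invN x (suc n) ≈ x * ehatS invQ invN x n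
      ehatS-suc x n = begin
        factor (suc n) * ((x * (x ^ n)) * invHatFact invQ invN (suc n))
          ≈⟨ *-congˡ (*-congˡ (invHatFact-suc n)) ⟩
        factor (suc n) * ((x * (x ^ n)) * ((invN n * invQ n) * invHatFact invQ invN n))
          ≈⟨ solve 5 (λ b x xn i f → b :* ((x :* xn) :* (i :* f)) := (i :* b) :* (x :* (xn :* f)))
               refl _ _ _ _ _ ⟩
        ((invN n * invQ n) * factor (suc n)) * (x * ehatS invQ invN x n)
          ≈⟨ trans (*-congʳ (factor-inverse n)) (*-identityˡ _) ⟩
        x * ehatS invQ invN x n ∎

      eS-scale : ∀ x n → eS invQ (p * x) n ≈ (p ^ n) * eS invQ x n
      eS-scale x n = trans (*-congʳ (^-distrib-* p x n)) (*-assoc _ _ _)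

      expProduct-scale : ∀ x k n → expProduct (λ j → p * x j) k n ≈ (p ^ n) * expProduct x k n
      expProduct-scale x zero    n = trans (*-congʳ (^-distrib-* p (x 0) n)) (*-assoc _ _ _)
      expProduct-scale x (suc k) n =
        trans (·S-cong n (eS-scale (x 0)) (expProduct-scale (x ∘ suc) k))
          (·S-scale p n (eS invQ (x 0)) (expProduct (x ∘ suc) k))

      expProduct-zero : ∀ x k → expProduct x k 0 ≈ 1#
      expProduct-zero x zero    = trans (*-identityˡ _) (*-identityˡ _)
      expProduct-zero x (suc k) = trans (·S-zero (eS invQ (x 0)) (expProduct (x ∘ suc) k))
        (trans (*-cong (*-identityˡ _) (expProduct-zero (x ∘ suc) k)) (*-identityˡ _))

      qint-suc : ∀ n → qint p (suc n) ≈ qint p n + (p ^ n)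
      qint-suc n = sumTo-snoc n (p ^_)

      qint-+ : ∀ m n → qint p (m ℕ.+ n) ≈ qint p m + (p ^ m) * qint p n
      qint-+ zero    n = sym (trans (+-identityˡ _) (*-identityˡ _))
      qint-+ (suc m) n = begin
        qint p (suc (m ℕ.+ n))
          ≈⟨ qint-suc (m ℕ.+ n) ⟩
        qint p (m ℕ.+ n) + (p ^ (m ℕ.+ n))
          ≈⟨ +-cong (qint-+ m n) (^-+ p m n) ⟩
        (qint p m + (p ^ m) * qint p n) + (p ^ m) * (p ^ n)
          ≈⟨ shuffle ⟩
        (qint p m + (p ^ m)) + (p * (p ^ m)) * qint p n
          ≈⟨ +-congʳ (qint-suc m) ⟨
        qint p (suc m) + (p ^ suc m) * qint p n ∎
        where
        qint-cons : qint p n + (p ^ n) ≈ 1# + p * qint p n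
        qint-cons = trans (sym (qint-suc n)) (trans (sumTo-cons n (p ^_)) (+-congˡ (sym (*-∑ (upTo n) p (p ^_)))))
        shuffle : (qint p m + (p ^ m) * qint p n) + (p ^ m) * (p ^ n) ≈
                  (qint p m + (p ^ m)) + (p * (p ^ m)) * qint p n
        shuffle = begin
          (qint p m + (p ^ m) * qint p n) + (p ^ m) * (p ^ n)
            ≈⟨ solve 4 (λ b x c y → (b :+ x :* c) :+ x :* y := b :+ x :* (c :+ y)) refl _ _ _ _ ⟩
          qint p m + (p ^ m) * (qint p n + (p ^ n))
            ≈⟨ +-congˡ (*-congˡ qint-cons) ⟩
          qint p m + (p ^ m) * (1# + p * qint p n)
            ≈⟨ solve 4 (λ b x p c → b :+ x :* (con 1 :+ p :* c) := (b :+ x) :+ (p :* x) :* c) refl _ _ _ _ ⟩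
          (qint p m + (p ^ m)) + (p * (p ^ m)) * qint p n ∎

      -- Splits the factor of a product of series so that [i] meets the left series and
      -- factor j the right one: the q-Leibniz rule.
      factor-split : ∀ i j f g → factor (i ℕ.+ j) * (f * g) ≈
        (qint p i * f) * (g + (a * (p ^ (i ℕ.+ j))) * ((p ^ j) * g)) + ((p ^ i) * f) * (factor j * g)
      factor-split i j f g = begin
        ((1# + a * (p ^ (i ℕ.+ j))) * qint p (i ℕ.+ j)) * (f * g)
          -- The multiple of `a` is split in the opposite order. Its part in [j]_p then carries p^i
          -- p^j and joins p^i [j]_p to form p^i times `factor j`.
          ≈⟨ *-congʳ (trans (distribʳ _ _ _) (+-cong
               (trans (*-identityˡ _) (qint-+ i j))
               (*-congˡ (trans (reflexive (≡.cong (qint p) (ℕₚ.+-comm i j))) (qint-+ j i))))) ⟩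
        ((qint p i + (p ^ i) * qint p j) + (a * (p ^ (i ℕ.+ j))) * (qint p j + (p ^ j) * qint p i)) * (f * g)
          ≈⟨ solve 8 (λ a P pi pj I J f g →
               ((I :+ pi :* J) :+ (a :* P) :* (J :+ pj :* I)) :* (f :* g) :=
               (I :* f) :* (g :+ (a :* P) :* (pj :* g)) :+ ((pi :* J :+ (a :* P) :* J) :* (f :* g)))
               refl _ _ _ _ _ _ _ _ ⟩
        (qint p i * f) * (g + (a * (p ^ (i ℕ.+ j))) * ((p ^ j) * g))
          + ((p ^ i) * qint p j + (a * (p ^ (i ℕ.+ j))) * qint p j) * (f * g)
          ≈⟨ +-congˡ (*-congʳ (+-congˡ (*-congʳ (*-congˡ (^-+ p i j))))) ⟩
        (qint p i * f) * (g + (a * (p ^ (i ℕ.+ j))) * ((p ^ j) * g))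
          + ((p ^ i) * qint p j + (a * ((p ^ i) * (p ^ j))) * qint p j) * (f * g)
          ≈⟨ +-congˡ (solve 6 (λ a pi pj J f g →
               (pi :* J :+ (a :* (pi :* pj)) :* J) :* (f :* g) :=
               (pi :* f) :* (((con 1 :+ a :* pj) :* J) :* g))
               refl _ _ _ _ _ _) ⟩
        (qint p i * f) * (g + (a * (p ^ (i ℕ.+ j))) * ((p ^ j) * g)) + ((p ^ i) * f) * (factor j * g) ∎

      -- Induction on `k`: the Leibniz rule acts either on the factor of colour 0, giving the terms
      -- `c = 0`, or on the remaining product, giving the others. Colour 0 lies below all others, so
      -- these scale `x 0` in the first sum and leave it alone in the second.
      expProduct-suc : ∀ x k n → factor (suc n) * expProduct x k (suc n) ≈
        sumTo (suc k) (λ c → x c * expProduct (scaleBelow c x) k n)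
          + (a * (p ^ suc n)) * sumTo k (λ c → x c * expProduct (scaleAbove c x) k n)
      expProduct-suc x zero    n = begin
        factor (suc n) * ehatS invQ invN (x 0) (suc n)
          ≈⟨ ehatS-suc (x 0) n ⟩
        x 0 * ehatS invQ invN (x 0) n
          ≈⟨ solve 2 (λ y z → y := (y :+ con 0) :+ z :* con 0) refl _ _ ⟩
        (x 0 * ehatS invQ invN (x 0) n + 0#) + (a * (p ^ suc n)) * 0# ∎
      expProduct-suc x (suc k) n = begin
        factor (suc n) * (e ·S g) (suc n)
          ≈⟨ *-∑ (upTo (suc (suc n))) _ _ ⟩
        sumTo (suc (suc n)) (λ i → factor (suc n) * (e i * g (suc n ∸ i)))
          ≈⟨ sumTo-cong (suc (suc n)) (λ { i (s≤s i≤sn) → leibniz i i≤sn }) ⟩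
        sumTo (suc (suc n)) (λ i → (qint p i * e i) * K (suc n ∸ i)
          + ((p ^ i) * e i) * (factor (suc n ∸ i) * g (suc n ∸ i)))
          ≈⟨ ∑-+ (upTo (suc (suc n))) _ _ ⟩
        ((λ i → qint p i * e i) ·S K) (suc n) + ((λ i → (p ^ i) * e i) ·S (λ j → factor j * g j)) (suc n)
          ≈⟨ +-cong left right ⟩
        (x 0 * (e ·S g) n + s * (x 0 * (e ·S gp) n))
          + (sumTo (suc k) (λ c → x (suc c) * (ep ·S gBelow c) n)
             + s * sumTo k (λ c → x (suc c) * (e ·S gAbove c) n))
          ≈⟨ solve 5 (λ a b c d s → (a :+ s :* b) :+ (c :+ s :* d) := (a :+ c) :+ s :* (b :+ d))
               refl _ _ _ _ _ ⟩
        (x 0 * (e ·S g) n + sumTo (suc k) (λ c → x (suc c) * (ep ·S gBelow c) n))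
          + s * (x 0 * (e ·S gp) n + sumTo k (λ c → x (suc c) * (e ·S gAbove c) n))
          -- The scalings match by computation: `scaleBelow 0` is the identity, `scaleAbove 0`
          -- scales all but `x 0`, and at `suc c` both restrict along `suc` to the scaling at `c`.
          ≈⟨ +-cong (sumTo-cons (suc k) _) (*-congˡ (sumTo-cons k _)) ⟨
        sumTo (suc (suc k)) (λ c → x c * expProduct (scaleBelow c x) (suc k) n)
          + s * sumTo (suc k) (λ c → x c * expProduct (scaleAbove c x) (suc k) n) ∎
        where
        x′ : ℕ → Carrier
        x′ = x ∘ suc
        s = a * (p ^ suc n)
        e g ep gp K : PS
        e  = eS invQ (x 0)
        g  = expProduct x′ k
        ep = eS invQ (p * x 0)
        gp = expProduct (λ j → p * x′ j) k
        K j = g j + s * ((p ^ j) * g j)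
        gBelow gAbove : ℕ → PS
        gBelow c = expProduct (scaleBelow c x′) k
        gAbove c = expProduct (scaleAbove c x′) k

        leibniz : ∀ i → i ≤ suc n → factor (suc n) * (e i * g (suc n ∸ i)) ≈
          (qint p i * e i) * K (suc n ∸ i) + ((p ^ i) * e i) * (factor (suc n ∸ i) * g (suc n ∸ i))
        leibniz i i≤sn = ≡.subst (λ m → factor m * (e i * g (suc n ∸ i)) ≈
          (qint p i * e i) * (g (suc n ∸ i) + (a * (p ^ m)) * ((p ^ (suc n ∸ i)) * g (suc n ∸ i)))
            + ((p ^ i) * e i) * (factor (suc n ∸ i) * g (suc n ∸ i)))
          (ℕₚ.m+[n∸m]≡n i≤sn) (factor-split i (suc n ∸ i) (e i) (g (suc n ∸ i)))

        -- The derivative falls on colour 0. The powers `p ^ j` in `K` amount to scaling every later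
        -- variable, as `scaleAbove 0` demands.
        left : ((λ i → qint p i * e i) ·S K) (suc n) ≈ x 0 * (e ·S g) n + s * (x 0 * (e ·S gp) n)
        left = begin
          ((λ i → qint p i * e i) ·S K) (suc n)
            ≈⟨ ·S-sucˡ n (λ i → qint p i * e i) K ⟩
          (0# * e 0) * K (suc n) + ((λ i → qint p (suc i) * e (suc i)) ·S K) n
            ≈⟨ trans (+-congʳ (trans (*-congʳ (zeroˡ _)) (zeroˡ _))) (+-identityˡ _) ⟩
          ((λ i → qint p (suc i) * e (suc i)) ·S K) n
            ≈⟨ ·S-cong n (eS-suc (x 0)) (λ j → +-congˡ {g j} (*-congˡ {s} (sym (expProduct-scale x′ k j)))) ⟩
          ((λ i → x 0 * e i) ·S (λ j → g j + s * gp j)) n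
            ≈⟨ trans (∑-cong (upTo (suc n)) (λ i →
                 solve 5 (λ y e g s h → (y :* e) :* (g :+ s :* h) := y :* (e :* g) :+ (s :* y) :* (e :* h))
                   refl _ _ _ _ _))
                 (∑-+ (upTo (suc n)) _ _) ⟩
          sumTo (suc n) (λ i → x 0 * (e i * g (n ∸ i))) + sumTo (suc n) (λ i → (s * x 0) * (e i * gp (n ∸ i)))
            ≈⟨ +-cong (*-∑ (upTo (suc n)) _ _) (trans (sym (*-assoc _ _ _)) (*-∑ (upTo (suc n)) _ _)) ⟨
          x 0 * (e ·S g) n + s * (x 0 * (e ·S gp) n) ∎

        ·S-sumTo : ∀ f m (y : ℕ → Carrier) (h : ℕ → PS) →
          sumTo (suc n) (λ i → f i * sumTo m (λ c → y c * h c (n ∸ i))) ≈ sumTo m (λ c → y c * (f ·S h c) n)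
        ·S-sumTo f m y h = begin
          sumTo (suc n) (λ i → f i * sumTo m (λ c → y c * h c (n ∸ i)))
            ≈⟨ ∑-cong (upTo (suc n)) (λ i → trans (*-∑ (upTo m) _ _) (∑-cong (upTo m) (λ c → *-leftComm _ _ _))) ⟩
          sumTo (suc n) (λ i → sumTo m (λ c → y c * (f i * h c (n ∸ i))))
            ≈⟨ ∑-swap (upTo (suc n)) (upTo m) _ ⟩
          sumTo m (λ c → sumTo (suc n) (λ i → y c * (f i * h c (n ∸ i))))
            ≈⟨ ∑-cong (upTo m) (λ c → *-∑ (upTo (suc n)) _ _) ⟨
          sumTo m (λ c → y c * (f ·S h c) n) ∎

        -- In the first sum `p ^ i` is absorbed by the series of colour 0, scaling `x 0`. In the
        -- second it completes the power of `p` to `p ^ suc n`, and that series stays as it was.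
        right-term : ∀ i → i ≤ n → ((p ^ i) * e i) * (factor (suc (n ∸ i)) * g (suc (n ∸ i))) ≈
          ep i * sumTo (suc k) (λ c → x′ c * gBelow c (n ∸ i))
            + s * (e i * sumTo k (λ c → x′ c * gAbove c (n ∸ i)))
        right-term i i≤n = begin
          ((p ^ i) * e i) * (factor (suc (n ∸ i)) * g (suc (n ∸ i)))
            ≈⟨ *-congˡ (expProduct-suc x′ k (n ∸ i)) ⟩
          ((p ^ i) * e i) * (S₁ + (a * (p * (p ^ (n ∸ i)))) * S₂)
            ≈⟨ solve 7 (λ pi e S₁ a p pj S₂ → (pi :* e) :* (S₁ :+ (a :* (p :* pj)) :* S₂) :=
                 (pi :* e) :* S₁ :+ (a :* (p :* (pi :* pj))) :* (e :* S₂)) refl _ _ _ _ _ _ _ ⟩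
          ((p ^ i) * e i) * S₁ + (a * (p * ((p ^ i) * (p ^ (n ∸ i))))) * (e i * S₂)
            ≈⟨ +-cong (*-congʳ (sym (eS-scale (x 0) i)))
                 (*-congʳ (*-congˡ (*-congˡ (trans (sym (^-+ p i (n ∸ i)))
                   (reflexive (≡.cong (p ^_) (ℕₚ.m+[n∸m]≡n i≤n))))))) ⟩
          ep i * S₁ + s * (e i * S₂) ∎
          where
          S₁ = sumTo (suc k) (λ c → x′ c * gBelow c (n ∸ i))
          S₂ = sumTo k (λ c → x′ c * gAbove c (n ∸ i))

        right : ((λ i → (p ^ i) * e i) ·S (λ j → factor j * g j)) (suc n) ≈
          sumTo (suc k) (λ c → x (suc c) * (ep ·S gBelow c) n)
            + s * sumTo k (λ c → x (suc c) * (e ·S gAbove c) n)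
        right = begin
          ((λ i → (p ^ i) * e i) ·S (λ j → factor j * g j)) (suc n)
            ≈⟨ ·S-sucʳ n (λ i → (p ^ i) * e i) (λ j → factor j * g j) ⟩
          ((λ i → (p ^ i) * e i) ·S (λ j → factor (suc j) * g (suc j))) n
            + ((p ^ suc n) * e (suc n)) * (factor 0 * g 0)
            -- `factor 0` contains the empty sum `qint p 0`, so the last term of the convolution
            -- vanishes.
            ≈⟨ trans (+-congˡ (trans (*-congˡ (trans (*-congʳ (zeroʳ _)) (zeroˡ _))) (zeroʳ _))) (+-identityʳ _) ⟩
          ((λ i → (p ^ i) * e i) ·S (λ j → factor (suc j) * g (suc j))) n
            ≈⟨ trans (sumTo-cong (suc n) (λ { i (s≤s i≤n) → right-term i i≤n })) (∑-+ (upTo (suc n)) _ _) ⟩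
          sumTo (suc n) (λ i → ep i * sumTo (suc k) (λ c → x′ c * gBelow c (n ∸ i)))
            + sumTo (suc n) (λ i → s * (e i * sumTo k (λ c → x′ c * gAbove c (n ∸ i))))
            ≈⟨ +-cong (·S-sumTo ep (suc k) x′ gBelow)
                 (trans (sym (*-∑ (upTo (suc n)) _ _)) (*-congˡ (·S-sumTo e k x′ gAbove))) ⟩
          sumTo (suc k) (λ c → x (suc c) * (ep ·S gBelow c) n)
            + s * sumTo k (λ c → x (suc c) * (e ·S gAbove c) n) ∎

      -- Both sides obey one recurrence in `n`, up to `factor (suc n)`, which is invertible by
      -- hypothesis. The induction hypothesis is needed at every scaled `x`.
      colouredSum≈expProduct : ∀ n x k → invHatFact invQ invN n * colouredSum n x k ≈ expProduct x k n
      colouredSum≈expProduct zero x k = trans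
        (solve 0 ((con 1 :* con 1) :* ((con 1 :* con 1) :* con 1 :+ con 0) := con 1) refl)
        (sym (expProduct-zero x k))
      colouredSum≈expProduct (suc n) x k = begin
        invHatFact invQ invN (suc n) * colouredSum (suc n) x k
          ≈⟨ *-cong (invHatFact-suc n) (colouredSum-suc n x k) ⟩
        ((invN n * invQ n) * h) * (sumTo (suc k) (λ c → x c * colouredSum n (scaleBelow c x) k)
          + s * sumTo k (λ c → x c * colouredSum n (scaleAbove c x) k))
          ≈⟨ solve 5 (λ i h S₁ s S₂ → (i :* h) :* (S₁ :+ s :* S₂) := i :* (h :* S₁ :+ s :* (h :* S₂)))
               refl _ _ _ _ _ ⟩
        (invN n * invQ n) * (h * sumTo (suc k) (λ c → x c * colouredSum n (scaleBelow c x) k)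
          + s * (h * sumTo k (λ c → x c * colouredSum n (scaleAbove c x) k)))
          ≈⟨ *-congˡ (+-cong (inductively (suc k) scaleBelow) (*-congˡ (inductively k scaleAbove))) ⟩
        (invN n * invQ n) * (sumTo (suc k) (λ c → x c * expProduct (scaleBelow c x) k n)
          + s * sumTo k (λ c → x c * expProduct (scaleAbove c x) k n))
          ≈⟨ *-congˡ (expProduct-suc x k n) ⟨
        (invN n * invQ n) * (factor (suc n) * expProduct x k (suc n))
          ≈⟨ trans (sym (*-assoc _ _ _)) (trans (*-congʳ (factor-inverse n)) (*-identityˡ _)) ⟩
        expProduct x k (suc n) ∎
        where
        h = invHatFact invQ invN n
        s = a * (p ^ suc n)
        inductively : ∀ m (scale : ℕ → (ℕ → Carrier) → ℕ → Carrier) →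
          h * sumTo m (λ c → x c * colouredSum n (scale c x) k) ≈
          sumTo m (λ c → x c * expProduct (scale c x) k n)
        inductively m scale = trans (*-∑ (upTo m) _ _) (∑-cong (upTo m) (λ c →
          trans (*-leftComm _ _ _) (*-congˡ (colouredSum≈expProduct n (scale c x) k))))

      prodS-expProduct : ∀ x k n →
        prodS (map (λ j → eS invQ (x j)) (upTo k) ++ (ehatS invQ invN (x k) ∷ [])) n ≈ expProduct x k n
      prodS-expProduct x zero    n = ·S-identityʳ n _
      prodS-expProduct x (suc k) n = begin
        prodS (map (λ j → eS invQ (x j)) (upTo (suc k)) ++ (ehatS invQ invN (x (suc k)) ∷ [])) n
          ≡⟨ ≡.cong (λ fs → prodS (fs ++ (ehatS invQ invN (x (suc k)) ∷ [])) n)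
               (map-upTo-suc k (λ j → eS invQ (x j))) ⟩
        (eS invQ (x 0) ·S
          prodS (map (λ j → eS invQ (x (suc j))) (upTo k) ++ (ehatS invQ invN (x (suc k)) ∷ []))) n
          ≈⟨ ·S-cong n (λ _ → refl) (prodS-expProduct (x ∘ suc) k) ⟩
        (eS invQ (x 0) ·S expProduct (x ∘ suc) k) n ∎

  -- Descents and the major index

  -- Multiplication by 1/(1 - t) forms partial sums.
  geom-1-·S : ∀ k g → (geom 1# ·S g) k ≈ sumTo (suc k) g
  geom-1-·S zero    g = +-congʳ (*-identityˡ _)
  geom-1-·S (suc k) g = begin
    (geom 1# ·S g) (suc k)
      ≈⟨ ·S-sucˡ k (geom 1#) g ⟩
    1# * g (suc k) + ((geom 1# ∘ suc) ·S g) k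
      ≈⟨ +-cong (*-identityˡ _) (trans (·S-cong k {g = g} (λ i → *-identityˡ _) (λ _ → refl)) (geom-1-·S k g)) ⟩
    g (suc k) + sumTo (suc k) g
      ≈⟨ +-comm _ _ ⟩
    sumTo (suc k) g + g (suc k)
      ≈⟨ sumTo-snoc (suc k) g ⟨
    sumTo (suc (suc k)) g ∎

  invPoch-zero : ∀ q k → invPoch q 0 k ≈ 1#
  invPoch-zero q k = trans (·S-identityʳ k _) (1^n≈1 k)

  -- The factor for j = 0 is 1/(1 - t). The others form 1/(qt;q)_{n+1}, the preceding series at qt,
  -- whence `q ^ c`.
  invPoch-suc : ∀ q n k → invPoch q (suc n) k ≈ sumTo (suc k) (λ c → (q ^ c) * invPoch q n c)
  invPoch-suc q n k = begin
    invPoch q (suc n) k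
      ≡⟨ ≡.cong (λ fs → prodS fs k) (map-upTo-suc (suc n) (λ j → geom (q ^ j))) ⟩
    (geom 1# ·S prodS (map (λ j → geom (q ^ suc j)) (upTo (suc n)))) k
      ≈⟨ ·S-cong k (λ _ → refl) (λ i → prodS-scale q i (upTo (suc n)) _ _ (λ j m → ^-distrib-* q (q ^ j) m)) ⟩
    (geom 1# ·S (λ c → (q ^ c) * invPoch q n c)) k
      ≈⟨ geom-1-·S k _ ⟩
    sumTo (suc k) (λ c → (q ^ c) * invPoch q n c) ∎

  shift-cong : ∀ d {f g} k → (∀ i → f i ≈ g i) → shift d f k ≈ shift d g k
  shift-cong zero    k       h = h k
  shift-cong (suc d) zero    h = refl
  shift-cong (suc d) (suc k) h = shift-cong d k h

  -- The operator sending f(t) to f(qt)/(1 - t) turns a factor t^d into q^d t^d.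
  sumTo-shift : ∀ q d f k → sumTo (suc k) (λ c → (q ^ c) * shift d f c) ≈
    (q ^ d) * shift d (λ i → sumTo (suc i) (λ c → (q ^ c) * f c)) k
  sumTo-shift q zero    f k       = sym (*-identityˡ _)
  sumTo-shift q (suc d) f zero    = trans (+-identityʳ _) (trans (zeroʳ _) (sym (zeroʳ _)))
  sumTo-shift q (suc d) f (suc k) = begin
    sumTo (suc (suc k)) (λ c → (q ^ c) * shift (suc d) f c)
      ≈⟨ sumTo-cons (suc k) _ ⟩
    1# * 0# + sumTo (suc k) (λ c → (q * (q ^ c)) * shift d f c)
      ≈⟨ trans (+-congʳ (zeroʳ _)) (+-identityˡ _) ⟩
    sumTo (suc k) (λ c → (q * (q ^ c)) * shift d f c)
      ≈⟨ trans (∑-cong (upTo (suc k)) (λ c → *-assoc _ _ _)) (sym (*-∑ (upTo (suc k)) _ _)) ⟩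
    q * sumTo (suc k) (λ c → (q ^ c) * shift d f c)
      ≈⟨ *-congˡ (sumTo-shift q d f k) ⟩
    q * ((q ^ d) * shift d (λ i → sumTo (suc i) (λ c → (q ^ c) * f c)) k)
      ≈⟨ *-assoc _ _ _ ⟨
    (q ^ suc d) * shift d (λ i → sumTo (suc i) (λ c → (q ^ c) * f c)) k ∎

  sumTo-bound-shift : ∀ q s d f k → sumTo (bound s k) (λ c → (q ^ c) * shift d f c) ≈
    (q ^ d) * shift (boolToℕ s ℕ.+ d) (λ i → sumTo (suc i) (λ c → (q ^ c) * f c)) k
  sumTo-bound-shift q false d f k       = sumTo-shift q d f k
  sumTo-bound-shift q true  d f zero    = sym (zeroʳ _)
  sumTo-bound-shift q true  d f (suc k) = sumTo-shift q d f k

  -- With β(0) = y, [tᵏ] of t^des q^maj / (t;q)ₙ₊₁ counts chains weighted by powers of q.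
  chains-powers : ∀ q y zs k → chains (q ^_) y zs k ≈
    (q ^ descentSum y zs) * shift (descentCount y zs) (invPoch q (length zs)) k
  chains-powers q y []       k = sym (trans (*-identityˡ _) (invPoch-zero q k))
  chains-powers q y (z ∷ zs) k = begin
    sumTo b (λ c → (q ^ c) * chains (q ^_) z zs c)
      ≈⟨ ∑-cong (upTo b) (λ c → trans (*-congˡ (chains-powers q z zs c)) (*-leftComm _ _ _)) ⟩
    sumTo b (λ c → (q ^ m) * ((q ^ c) * shift d h c))
      ≈⟨ *-∑ (upTo b) _ _ ⟨
    (q ^ m) * sumTo b (λ c → (q ^ c) * shift d h c)
      ≈⟨ *-congˡ (sumTo-bound-shift q (y >ᵇ z) d h k) ⟩
    (q ^ m) * ((q ^ d) * shift (boolToℕ (y >ᵇ z) ℕ.+ d) (λ i → sumTo (suc i) (λ c → (q ^ c) * h c)) k)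
      -- `q ^ d` is the growth of the major index when the `d` descents of `z ∷ zs` each move one
      -- place to the right.
      ≈⟨ trans (sym (*-assoc _ _ _)) (*-cong (trans (*-comm _ _) (sym (^-+ q d m)))
           (shift-cong (boolToℕ (y >ᵇ z) ℕ.+ d) k (λ i → sym (invPoch-suc q (length zs) i)))) ⟩
    (q ^ (d ℕ.+ m)) * shift (boolToℕ (y >ᵇ z) ℕ.+ d) (invPoch q (suc (length zs))) k
      ≡⟨ ≡.cong₂ (λ m d → (q ^ m) * shift d (invPoch q (suc (length zs))) k)
           (descentSum-∷ y z zs) (descentCount-∷ y z zs) ⟨
    (q ^ descentSum y (z ∷ zs)) * shift (descentCount y (z ∷ zs)) (invPoch q (suc (length zs))) k ∎
    where
    b = bound (y >ᵇ z) k
    d = descentCount z zs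
    m = descentSum z zs
    h = invPoch q (length zs)

  ·S-desPoly : ∀ q p a n k → (invPoch q n ·S desPoly q p a n) k ≈ Statistics.colouredSum p a n (q ^_) k
  ·S-desPoly q p a n k = begin
    sumTo (suc k) (λ i → invPoch q n i * ∑Perms n n (λ β → mono β (k ∸ i)))
      ≈⟨ ∑-cong (upTo (suc k)) (λ i → *-∑ (signedPerms n n) _ _) ⟩
    sumTo (suc k) (λ i → ∑Perms n n (λ β → invPoch q n i * mono β (k ∸ i)))
      ≈⟨ ∑-swap (upTo (suc k)) (signedPerms n n) _ ⟩
    ∑Perms n n (λ β → (invPoch q n ·S mono β) k)
      ≈⟨ ∑-cong∈ (signedPerms n n) (λ {β} β∈ → term β (proj₁ (∈-signedPerms⁻ n n β∈))) ⟩
    colouredSum n (q ^_) k ∎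
    where
    open Statistics p a
    mono : List ℤ → PS
    mono β i = if desB β ≡ᵇ i then (q ^ maj β) * weight β else 0#

    term : ∀ β → length β ≡ n → (invPoch q n ·S mono β) k ≈ weightedChains (q ^_) k β
    term β ≡.refl = begin
      (invPoch q n ·S mono β) k
        ≈⟨ ·S-monomial (desB β) ((q ^ maj β) * weight β) (invPoch q n) k ⟩
      shift (desB β) (invPoch q n) k * ((q ^ maj β) * weight β)
        ≈⟨ solve 3 (λ s m w → s :* (m :* w) := w :* (m :* s)) refl _ _ _ ⟩
      weight β * ((q ^ maj β) * shift (desB β) (invPoch q n) k)
        ≈⟨ *-congˡ (chains-powers q (+ 0) β k) ⟨
      weightedChains (q ^_) k β ∎

theorem5p1 : ∀ {c ℓ : Level} (R : CommutativeRing c ℓ) →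
    let open CommutativeRing R
        open Series R
    in (q p a : Carrier) (invQ invN : ℕ → Carrier) →
       (∀ m → qint p (suc m) * invQ m ≈ 1#) →
       (∀ i → (1# + a * (p ^ suc i)) * invN i ≈ 1#) →
       ∀ n k → lhsCoeff q p a invQ invN n k ≈ rhsCoeff q p a invQ invN n k
theorem5p1 R q p a invQ invN invQ-inverse invN-inverse n k = begin
  lhsCoeff q p a invQ invN n k
    -- The special form of the variables matters in this step alone; the two that follow hold for
    -- every `x`.
    ≈⟨ *-congˡ (·S-desPoly q p a n k) ⟩
  invHatFact invQ invN n * colouredSum n (q ^_) k
    ≈⟨ colouredSum≈expProduct n (q ^_) k ⟩
  expProduct (q ^_) k n
    ≈⟨ prodS-expProduct (q ^_) k n ⟨
  rhsCoeff q p a invQ invN n k ∎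
  where
  open CommutativeRing R hiding (zero)
  open Series R
  open Generating R
  open Statistics p a
  open Exponentials invQ invN invQ-inverse invN-inverse
  open SetoidReasoning setoid
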